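{- Let $G$ be a connected series-parallel graph. Then there exists $\varepsilon > 0$ such that $\mathrm{ex}(Q_n, X(G)) = O(n^{ -\varepsilon} 2^n)$ as $n \to \infty$.
   Context: Graphs here may be multigraphs (loops and parallel edges allowed). A series-parallel graph is a multigraph with no $K_4$ minor. A spanning tree of a multigraph is a set of edges forming a tree containing every vertex. $Q_n$ is the $n$-dimensional hypercube with vertex set $\{0,1\}^n$. For $d \le n$, an embedding $Q_d \to Q_n$ is a graph isomorphism of $Q_d$ onto a $d$-dimensional face (subcube) of $Q_n$. For $X \subseteq V(Q_d)$, $\mathrm{ex}(Q_n, X)$ is the maximum size of a set $S \subseteq V(Q_n)$ such that $\psi(X) \not\subseteq S$ for every embedding $\psi: Q_d \to Q_n$. For a connected multigraph $G$ with a fixed ordering of $E(G)$, $X(G) \subseteq \{0,1\}^{E(G)} = V(Q_{e(G)})$ is the set of indicator strings of edge sets of spanning trees of $G$ (here $e(G) = |E(G)|$). -}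

module Defs where

open import Data.Nat using (ℕ; zero; suc; _+_; _*_; _^_; _≤_)
open import Data.Bool using (Bool; true; false; if_then_else_; _xor_)
open import Data.Fin using (Fin)
open import Data.Vec using (Vec; []; _∷_; lookup; _[_]≔_; allFin)
open import Data.List using (List; [_]; _++_; map)
open import Data.Nat.ListAction using (sum)
open import Data.Product using (_×_; _,_; proj₁; proj₂; Σ; ∃; ∃-syntax)
open import Data.Sum using (_⊎_)
open import Relation.Nullary using (¬_)
open import Relation.Binary.PropositionalEquality using (_≡_; _≢_)

-- Multigraphs: vertex set Fin v, edge set Fin m (this fixes the edge
-- ordering), each edge has an (unordered) pair of endpoints; loops and
-- parallel edges are allowed.

record Multigraph (v m : ℕ) : Set where
  field
    ends : Fin m → Fin v × Fin v

open Multigraph public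

module _ {v m : ℕ} (G : Multigraph v m) where

  Joins : Fin m → Fin v → Fin v → Set
  Joins e x y = (ends G e ≡ (x , y)) ⊎ (ends G e ≡ (y , x))

  data Reach (T : Vec Bool m) : Fin v → Fin v → Set where
    here : ∀ {x} → Reach T x x
    step : ∀ {x y z} (e : Fin m) → lookup T e ≡ true → Joins e x y →
           Reach T y z → Reach T x z

  ConnectedVia : Vec Bool m → Set
  ConnectedVia T = ∀ x y → Reach T x y

  -- the subgraph (V(G), T) is acyclic: no edge of T lies on a cycle of T,
  -- i.e. the endpoints of each e ∈ T are not joined in T ∖ {e}
  -- (for a loop the endpoints coincide, so loops are cycles).
  AcyclicVia : Vec Bool m → Set
  AcyclicVia T = ∀ e → lookup T e ≡ true →
    ¬ Reach (T [ e ]≔ false) (proj₁ (ends G e)) (proj₂ (ends G e))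

  allEdges : ∀ {k} → Vec Bool k
  allEdges {zero} = []
  allEdges {suc k} = true ∷ allEdges

  Connected : Set
  Connected = (1 ≤ v) × ConnectedVia allEdges

  X : Vec Bool m → Set
  X T = ConnectedVia T × AcyclicVia T

  inducedEdges : (Fin v → Bool) → Vec Bool m
  inducedEdges B = go (allFin m)
    where
      go : ∀ {k} → Vec (Fin m) k → Vec Bool k
      go [] = []
      go (e ∷ es) = (if B (proj₁ (ends G e)) then B (proj₂ (ends G e)) else false) ∷ go es

  record K4Model : Set where
    field
      branch   : Fin 4 → Fin v → Bool
      nonempty : ∀ i → ∃[ x ] branch i x ≡ true
      disjoint : ∀ i j x → i ≢ j → branch i x ≡ true → branch j x ≡ false
      conn     : ∀ i x y → branch i x ≡ true → branch i y ≡ true →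
                 Reach (inducedEdges (branch i)) x y
      adjacent : ∀ i j → i ≢ j → ∃[ e ] ∃[ x ] ∃[ y ]
                 (Joins e x y × branch i x ≡ true × branch j y ≡ true)

  SeriesParallel : Set
  SeriesParallel = ¬ K4Model

countTrue : ∀ {n} → Vec Bool n → ℕ
countTrue [] = 0
countTrue (b ∷ bs) = (if b then 1 else 0) + countTrue bs

hamming : ∀ {n} → Vec Bool n → Vec Bool n → ℕ
hamming [] [] = 0
hamming (a ∷ as) (b ∷ bs) = (if a xor b then 1 else 0) + hamming as bs

QAdj : ∀ {n} → Vec Bool n → Vec Bool n → Set
QAdj x y = hamming x y ≡ 1

allVecs : (n : ℕ) → List (Vec Bool n)
allVecs zero = [ [] ]
allVecs (suc n) = map (false ∷_) (allVecs n) ++ map (true ∷_) (allVecs n)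

card : ∀ {n} → (Vec Bool n → Bool) → ℕ
card {n} S = sum (map (λ y → if S y then 1 else 0) (allVecs n))

record Face (d n : ℕ) : Set where
  field
    free  : Vec Bool n
    dim   : countTrue free ≡ d
    base  : Vec Bool n

InFace : ∀ {d n} → Face d n → Vec Bool n → Set
InFace F y = ∀ j → lookup (Face.free F) j ≡ false → lookup y j ≡ lookup (Face.base F) j

record Embedding (d n : ℕ) : Set where
  field
    ψ        : Vec Bool d → Vec Bool n
    injective : ∀ x y → ψ x ≡ ψ y → x ≡ y
    adj→     : ∀ x y → QAdj x y → QAdj (ψ x) (ψ y)
    adj←     : ∀ x y → QAdj (ψ x) (ψ y) → QAdj x y
    face     : Face d n
    into     : ∀ x → InFace face (ψ x)
    onto     : ∀ y → InFace face y → ∃[ x ] ψ x ≡ y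

XFree : ∀ {d n} → (Vec Bool d → Set) → (Vec Bool n → Bool) → Set
XFree {d} {n} X S = ∀ (φ : Embedding d n) →
  ¬ (∀ x → X x → S (Embedding.ψ φ x) ≡ true)

-- Call a set P of points of Q_m good if for some q every S ⊆ Q_n of density δ contains at least a
-- fraction δ^q of all translates and (possibly degenerate) placements of P. Degenerate placements
-- have measure O(1/n), so the spanning tree set of G being good gives |S|^q n ≤ m² 2^{nq} for free S.
-- Adding a constant coordinate preserves goodness. So does doubling a coordinate, 0 ↦ 00 and
-- 1 ↦ 01, 10, or the same with 0 and 1 exchanged, by the Cauchy–Schwarz inequality, with q doubled.
-- On spanning trees these operations are the addition of a loop or a pendant edge, of a parallel
-- edge, and the subdivision of an edge. It remains to see that a graph without K₄ minor is reduced by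
-- their inverses to a point: a simple graph all of whose degrees, except perhaps that of one
-- nonisolated root, are 0 or at least 3 has a K₄ minor, because otherwise some contractions would
-- give a smaller such graph.
module Submission where

open import Defs
open import Data.Bool using (Bool; true; false; not; _∧_; _xor_; if_then_else_)
open import Data.Bool.Properties using (xor-comm; xor-assoc; xor-same; xor-identityʳ; ∧-zeroʳ; ∧-identityʳ) renaming (_≟_ to _≟ᵇ_)
open import Data.Empty using (⊥-elim)
open import Data.Fin using (Fin; zero; suc; _≟_)
open import Data.Fin.Properties using (any?)
open import Data.List using (List; []; _∷_; _++_; map; concatMap; length; allFin)
open import Data.List.Properties using (map-++; map-∘; map-cong; map-tabulate; length-tabulate; length-map; length-++)
open import Data.Nat using (ℕ; zero; suc; _+_; _*_; _^_; _≤_; _<_; z≤n; s≤s; NonZero)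
open import Data.Nat.ListAction using (sum)
open import Data.Nat.ListAction.Properties using (sum-++)
open import Data.Nat.Properties hiding (_≟_)
open import Data.Nat.Solver using (module +-*-Solver)
open import Data.Product using (_×_; _,_; proj₁; proj₂; ∃; ∃-syntax)
open import Data.Sum using (_⊎_; inj₁; inj₂; [_,_]′)
open import Data.Vec as Vec using (Vec; []; _∷_; lookup; _[_]≔_; zipWith; replicate)
open import Data.Vec.Properties using ([]≔-commutes; []≔-idempotent; lookup∘update; lookup∘update′; lookup-map; lookup-zipWith; lookup-replicate; lookup-allFin)
open import Data.Vec.Relation.Binary.Pointwise.Extensional using (ext; Pointwise-≡⇒≡)
open import Function using (_∘_)
open import Relation.Binary.PropositionalEquality
open import Relation.Nullary using (Dec; yes; no; ¬_; ¬?; _×-dec_; _⊎-dec_)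
open import Relation.Nullary.Decidable using (⌊_⌋)

-- Repeated directions cannot be avoided: Cauchy-Schwarz pairs each value `i` of the doubled
-- direction with every `j`, `i ≡ j` included. Admitting them from the start keeps the directions
-- independent, and the loss is paid once, at the end. Dropping a coordinate or contracting an edge
-- would change the types. So all coordinates, edges and vertices of `G` stay: a mask `L` marks the
-- live coordinates, and a minor is `L` together with a labelling of the vertices and a set of
-- contracted edges. Spanning trees are replaced by minimal connected edge sets, for which
-- exchanging edges is a matter of reachability alone. In the search for K₄, contracting an edge may
-- cost a common neighbour one degree and may leave the merged vertex with few neighbours. Merging
-- into the root, which is exempt, disposes of the second defect.

∑ : {A : Set} → List A → (A → ℕ) → ℕ
∑ xs f = sum (map f xs)

𝟙 : Bool → ℕ
𝟙 b = if b then 1 else 0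

-- Finite sums and the Cauchy-Schwarz inequality

module _ {A : Set} where

  ∑-cong : ∀ (xs : List A) {f g : A → ℕ} → (∀ x → f x ≡ g x) → ∑ xs f ≡ ∑ xs g
  ∑-cong xs f≗g = cong sum (map-cong f≗g xs)

  ∑-mono : ∀ (xs : List A) {f g : A → ℕ} → (∀ x → f x ≤ g x) → ∑ xs f ≤ ∑ xs g
  ∑-mono []       f≤g = z≤n
  ∑-mono (x ∷ xs) f≤g = +-mono-≤ (f≤g x) (∑-mono xs f≤g)

  ∑-++ : ∀ (xs ys : List A) (f : A → ℕ) → ∑ (xs ++ ys) f ≡ ∑ xs f + ∑ ys f
  ∑-++ xs ys f = trans (cong sum (map-++ f xs ys)) (sum-++ (map f xs) (map f ys))

  ∑-+ : ∀ (xs : List A) (f g : A → ℕ) → ∑ xs (λ x → f x + g x) ≡ ∑ xs f + ∑ xs g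
  ∑-+ []       f g = refl
  ∑-+ (x ∷ xs) f g = trans (cong (f x + g x +_) (∑-+ xs f g))
    (solve 4 (λ a b c d → a :+ b :+ (c :+ d) := a :+ c :+ (b :+ d)) refl (f x) (g x) (∑ xs f) (∑ xs g))
    where open +-*-Solver

  ∑-*ˡ : ∀ k (xs : List A) (f : A → ℕ) → ∑ xs (λ x → k * f x) ≡ k * ∑ xs f
  ∑-*ˡ k []       f = sym (*-zeroʳ k)
  ∑-*ˡ k (x ∷ xs) f = trans (cong (k * f x +_) (∑-*ˡ k xs f)) (sym (*-distribˡ-+ k (f x) (∑ xs f)))

  ∑-*ʳ : ∀ k (xs : List A) (f : A → ℕ) → ∑ xs (λ x → f x * k) ≡ ∑ xs f * k
  ∑-*ʳ k xs f = trans (∑-cong xs (λ x → *-comm (f x) k)) (trans (∑-*ˡ k xs f) (*-comm k (∑ xs f)))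

  ∑-const : ∀ k (xs : List A) → ∑ xs (λ _ → k) ≡ length xs * k
  ∑-const k []       = refl
  ∑-const k (x ∷ xs) = cong (k +_) (∑-const k xs)

∑-map : ∀ {A B : Set} (h : A → B) (xs : List A) (f : B → ℕ) → ∑ (map h xs) f ≡ ∑ xs (f ∘ h)
∑-map h xs f = cong sum (sym (map-∘ xs))

∑-concatMap : ∀ {A B : Set} (h : A → List B) (xs : List A) (f : B → ℕ) →
  ∑ (concatMap h xs) f ≡ ∑ xs (λ x → ∑ (h x) f)
∑-concatMap h []       f = refl
∑-concatMap h (x ∷ xs) f = trans (∑-++ (h x) (concatMap h xs) f) (cong (∑ (h x) f +_) (∑-concatMap h xs f))

∑-swap : ∀ {A B : Set} (xs : List A) (ys : List B) (f : A → B → ℕ) →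
  ∑ xs (λ x → ∑ ys (f x)) ≡ ∑ ys (λ y → ∑ xs (λ x → f x y))
∑-swap []       ys f = sym (trans (∑-const 0 ys) (*-zeroʳ (length ys)))
∑-swap (x ∷ xs) ys f = trans (cong (∑ ys (f x) +_) (∑-swap xs ys f)) (sym (∑-+ ys (f x) _))

∑-*-∑ : ∀ {A B : Set} (xs : List A) (ys : List B) (f : A → ℕ) (g : B → ℕ) →
  ∑ xs (λ x → ∑ ys (λ y → f x * g y)) ≡ ∑ xs f * ∑ ys g
∑-*-∑ xs ys f g = trans (∑-cong xs (λ x → ∑-*ˡ (f x) ys g)) (∑-*ʳ (∑ ys g) xs f)

2ab≤a²+b² : ∀ a b → 2 * (a * b) ≤ a * a + b * b
2ab≤a²+b² a b with ≤-total a b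
... | inj₁ a≤b with m≤n⇒∃[o]m+o≡n a≤b
...   | c , refl = subst (2 * (a * (a + c)) ≤_)
        (solve 2 (λ a c → con 2 :* (a :* (a :+ c)) :+ c :* c := a :* a :+ (a :+ c) :* (a :+ c)) refl a c)
        (m≤m+n _ (c * c))
        where open +-*-Solver
2ab≤a²+b² a b | inj₂ b≤a with m≤n⇒∃[o]m+o≡n b≤a
...   | c , refl = subst (2 * ((b + c) * b) ≤_)
        (solve 2 (λ b c → con 2 :* ((b :+ c) :* b) :+ c :* c := (b :+ c) :* (b :+ c) :+ b :* b) refl b c)
        (m≤m+n _ (c * c))
        where open +-*-Solver

cauchy-schwarz : ∀ {A : Set} (xs : List A) (f : A → ℕ) →
  ∑ xs f * ∑ xs f ≤ length xs * ∑ xs (λ x → f x * f x)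
cauchy-schwarz []       f = z≤n
cauchy-schwarz (x ∷ xs) f = begin
  (a + s) * (a + s)                   ≡⟨ solve 2 (λ a s → (a :+ s) :* (a :+ s) := a :* a :+ con 2 :* a :* s :+ s :* s) refl a s ⟩
  a * a + 2 * a * s + s * s           ≤⟨ +-mono-≤ (+-monoʳ-≤ (a * a) cross) (cauchy-schwarz xs f) ⟩
  a * a + (l * (a * a) + Q) + l * Q   ≡⟨ solve 3 (λ a l Q → a :* a :+ (l :* (a :* a) :+ Q) :+ l :* Q := (con 1 :+ l) :* (a :* a :+ Q)) refl a l Q ⟩
  suc l * (a * a + Q)                 ∎
  where
  open ≤-Reasoning
  open +-*-Solver
  a = f x
  s = ∑ xs f
  l = length xs
  Q = ∑ xs (λ x → f x * f x)
  cross : 2 * a * s ≤ l * (a * a) + Q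
  cross = begin
    2 * a * s                                ≡⟨ ∑-*ˡ (2 * a) xs f ⟨
    ∑ xs (λ x → 2 * a * f x)                 ≤⟨ ∑-mono xs (λ x → ≤-trans (≤-reflexive (*-assoc 2 a (f x))) (2ab≤a²+b² a (f x))) ⟩
    ∑ xs (λ x → a * a + f x * f x)           ≡⟨ ∑-+ xs _ _ ⟩
    ∑ xs (λ _ → a * a) + Q                   ≡⟨ cong (_+ Q) (∑-const (a * a) xs) ⟩
    l * (a * a) + Q                          ∎

cauchy-schwarz₂ : ∀ {A B : Set} (xs : List A) (ys : List B) (f : A → B → ℕ) →
  ∑ xs (λ x → ∑ ys (f x)) * ∑ xs (λ x → ∑ ys (f x)) ≤
  length xs * length ys * ∑ xs (λ x → ∑ ys (λ y → f x y * f x y))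
cauchy-schwarz₂ xs ys f = begin
  ∑ xs (λ x → ∑ ys (f x)) * ∑ xs (λ x → ∑ ys (f x))                ≤⟨ cauchy-schwarz xs _ ⟩
  length xs * ∑ xs (λ x → ∑ ys (f x) * ∑ ys (f x))                 ≤⟨ *-monoʳ-≤ (length xs) (∑-mono xs (λ x → cauchy-schwarz ys (f x))) ⟩
  length xs * ∑ xs (λ x → length ys * ∑ ys (λ y → f x y * f x y))  ≡⟨ cong (length xs *_) (∑-*ˡ (length ys) xs _) ⟩
  length xs * (length ys * ∑ xs (λ x → ∑ ys (λ y → f x y * f x y))) ≡⟨ *-assoc (length xs) (length ys) _ ⟨
  length xs * length ys * ∑ xs (λ x → ∑ ys (λ y → f x y * f x y))  ∎
  where open ≤-Reasoning

length-allVecs : ∀ n → length (allVecs n) ≡ 2 ^ n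
length-allVecs zero    = refl
length-allVecs (suc n) = trans (length-++ (map (false ∷_) (allVecs n)))
  (cong₂ _+_ (trans (length-map _ (allVecs n)) (length-allVecs n))
             (trans (length-map _ (allVecs n)) (trans (length-allVecs n) (sym (+-identityʳ _)))))

-- Placements of a cube in Q_n

-- The directions of a placement. Repetitions are kept, so that the entries are independent and each
-- can be summed over on its own.
tuples : (n m : ℕ) → List (Vec (Fin n) m)
tuples n zero    = [] ∷ []
tuples n (suc m) = concatMap (λ i → map (i ∷_) (tuples n m)) (allFin n)

∑-tuples : ∀ {n m} (f : Vec (Fin n) (suc m) → ℕ) →
  ∑ (tuples n (suc m)) f ≡ ∑ (allFin n) (λ i → ∑ (tuples n m) (λ σ → f (i ∷ σ)))
∑-tuples {n} {m} f = trans (∑-concatMap _ (allFin n) f) (∑-cong (allFin n) (λ i → ∑-map (i ∷_) (tuples n m) f))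

∑-allFin-const : ∀ n k → ∑ (allFin n) (λ _ → k) ≡ n * k
∑-allFin-const n k = trans (∑-const k (allFin n)) (cong (_* k) (length-tabulate {n = n} (λ i → i)))

-- Overwriting forgets the old entry, so every tuple arises once for each of the `n` values that the
-- entry may have had before.
∑-resample : ∀ {n m} (e : Fin m) (g : Vec (Fin n) m → ℕ) →
  ∑ (tuples n m) (λ σ → ∑ (allFin n) (λ i → g (σ [ e ]≔ i))) ≡ n * ∑ (tuples n m) g
∑-resample {n} {suc m} zero g = begin
  ∑ (tuples n (suc m)) (λ σ → ∑ (allFin n) (λ i → g (σ [ zero ]≔ i)))  ≡⟨ ∑-tuples {m = m} (λ σ → ∑ (allFin n) (λ i → g (σ [ zero ]≔ i))) ⟩
  ∑ (allFin n) (λ _ → ∑ (tuples n m) (λ σ → ∑ (allFin n) (λ i → g (i ∷ σ))))  ≡⟨ ∑-allFin-const n _ ⟩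
  n * ∑ (tuples n m) (λ σ → ∑ (allFin n) (λ i → g (i ∷ σ)))  ≡⟨ cong (n *_) (∑-swap (tuples n m) (allFin n) _) ⟩
  n * ∑ (allFin n) (λ i → ∑ (tuples n m) (λ σ → g (i ∷ σ)))  ≡⟨ cong (n *_) (∑-tuples {m = m} g) ⟨
  n * ∑ (tuples n (suc m)) g  ∎
  where open ≡-Reasoning
∑-resample {n} {suc m} (suc e) g = begin
  ∑ (tuples n (suc m)) (λ σ → ∑ (allFin n) (λ i → g (σ [ suc e ]≔ i)))  ≡⟨ ∑-tuples {m = m} (λ σ → ∑ (allFin n) (λ i → g (σ [ suc e ]≔ i))) ⟩
  ∑ (allFin n) (λ j → ∑ (tuples n m) (λ σ → ∑ (allFin n) (λ i → g (j ∷ (σ [ e ]≔ i)))))  ≡⟨ ∑-cong (allFin n) (λ j → ∑-resample e (λ σ → g (j ∷ σ))) ⟩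
  ∑ (allFin n) (λ j → n * ∑ (tuples n m) (λ σ → g (j ∷ σ)))  ≡⟨ ∑-*ˡ n (allFin n) _ ⟩
  n * ∑ (allFin n) (λ j → ∑ (tuples n m) (λ σ → g (j ∷ σ)))  ≡⟨ cong (n *_) (∑-tuples {m = m} g) ⟨
  n * ∑ (tuples n (suc m)) g  ∎
  where open ≡-Reasoning

flip : ∀ {n} → Bool → Fin n → Vec Bool n → Vec Bool n
flip b zero    (x ∷ y) = (b xor x) ∷ y
flip b (suc i) (x ∷ y) = x ∷ flip b i y

-- In 𝔽₂ⁿ this is `y` plus the unit vectors in the directions of those coordinates where `x` is
-- true. Flips in a repeated direction cancel in pairs; such placements are the degenerate ones.
act : ∀ {n m} → Vec (Fin n) m → Vec Bool m → Vec Bool n → Vec Bool n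
act []      []      y = y
act (i ∷ σ) (b ∷ x) y = flip b i (act σ x y)

flip-false : ∀ {n} (i : Fin n) y → flip false i y ≡ y
flip-false zero    (x ∷ y) = refl
flip-false (suc i) (x ∷ y) = cong (x ∷_) (flip-false i y)

flip-involutive : ∀ {n} b (i : Fin n) y → flip b i (flip b i y) ≡ y
flip-involutive false zero    (x ∷ y)     = refl
flip-involutive true  zero    (false ∷ y) = refl
flip-involutive true  zero    (true ∷ y)  = refl
flip-involutive b     (suc i) (x ∷ y)     = cong (x ∷_) (flip-involutive b i y)

flip-comm : ∀ {n} b c (i j : Fin n) y → flip b i (flip c j y) ≡ flip c j (flip b i y)
flip-comm b c zero    zero    (x ∷ y) =
  cong (_∷ y) (trans (sym (xor-assoc b c x)) (trans (cong (_xor x) (xor-comm b c)) (xor-assoc c b x)))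
flip-comm b c zero    (suc j) (x ∷ y) = refl
flip-comm b c (suc i) zero    (x ∷ y) = refl
flip-comm b c (suc i) (suc j) (x ∷ y) = cong (x ∷_) (flip-comm b c i j y)

flip-act : ∀ {n m} b i (σ : Vec (Fin n) m) x y → flip b i (act σ x y) ≡ act σ x (flip b i y)
flip-act b i []      []      y = refl
flip-act b i (j ∷ σ) (c ∷ x) y = trans (flip-comm b c i j _) (cong (flip c j) (flip-act b i σ x y))

act-split : ∀ {n m} (σ : Vec (Fin n) m) x e y →
  act σ x y ≡ flip (lookup x e) (lookup σ e) (act σ (x [ e ]≔ false) y)
act-split (i ∷ σ) (b ∷ x) zero    y = cong (flip b i) (sym (flip-false i _))
act-split (i ∷ σ) (b ∷ x) (suc e) y = trans (cong (flip b i) (act-split σ x e y)) (flip-comm b _ i _ _)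

act-resample : ∀ {n m} (σ : Vec (Fin n) m) x e i y →
  act (σ [ e ]≔ i) (x [ e ]≔ false) y ≡ act σ (x [ e ]≔ false) y
act-resample (j ∷ σ) (b ∷ x) zero    i y = trans (flip-false i _) (sym (flip-false j _))
act-resample (j ∷ σ) (b ∷ x) (suc e) i y = cong (flip b j) (act-resample σ x e i y)

act-replicate-false : ∀ {n m} (σ : Vec (Fin n) m) y → act σ (replicate m false) y ≡ y
act-replicate-false []      y = refl
act-replicate-false (i ∷ σ) y = trans (flip-false i _) (act-replicate-false σ y)

∑-flip : ∀ {n} b (i : Fin n) (g : Vec Bool n → ℕ) → ∑ (allVecs n) (λ y → g (flip b i y)) ≡ ∑ (allVecs n) g
∑-flip {suc n} b i g = begin
  ∑ (allVecs (suc n)) (λ y → g (flip b i y))  ≡⟨ halves _ ⟩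
  ∑ (allVecs n) (λ y → g (flip b i (false ∷ y))) + ∑ (allVecs n) (λ y → g (flip b i (true ∷ y)))  ≡⟨ cases b i ⟩
  ∑ (allVecs n) (λ y → g (false ∷ y)) + ∑ (allVecs n) (λ y → g (true ∷ y))  ≡⟨ halves g ⟨
  ∑ (allVecs (suc n)) g  ∎
  where
  open ≡-Reasoning
  halves : ∀ (f : Vec Bool (suc n) → ℕ) → ∑ (allVecs (suc n)) f ≡ ∑ (allVecs n) (f ∘ (false ∷_)) + ∑ (allVecs n) (f ∘ (true ∷_))
  halves f = trans (∑-++ (map (false ∷_) (allVecs n)) _ f) (cong₂ _+_ (∑-map _ (allVecs n) f) (∑-map _ (allVecs n) f))
  cases : ∀ b i → ∑ (allVecs n) (λ y → g (flip b i (false ∷ y))) + ∑ (allVecs n) (λ y → g (flip b i (true ∷ y)))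
    ≡ ∑ (allVecs n) (λ y → g (false ∷ y)) + ∑ (allVecs n) (λ y → g (true ∷ y))
  cases false zero    = refl
  cases true  zero    = +-comm (∑ (allVecs n) (λ y → g (true ∷ y))) _
  cases b     (suc i) = cong₂ _+_ (∑-flip b i (g ∘ (false ∷_))) (∑-flip b i (g ∘ (true ∷_)))

-- Masks of live coordinates, and the operations that preserve goodness

zipWith-∧-remove : ∀ {m} (x L : Vec Bool m) f → zipWith _∧_ x (L [ f ]≔ false) ≡ zipWith _∧_ x L [ f ]≔ false
zipWith-∧-remove (b ∷ x) (l ∷ L) zero    = cong (_∷ _) (∧-zeroʳ b)
zipWith-∧-remove (b ∷ x) (l ∷ L) (suc f) = cong (_ ∷_) (zipWith-∧-remove x L f)

zipWith-∧-update : ∀ {m} (x L : Vec Bool m) e b →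
  zipWith _∧_ (x [ e ]≔ b) L ≡ zipWith _∧_ x L [ e ]≔ (b ∧ lookup L e)
zipWith-∧-update (a ∷ x) (l ∷ L) zero    b = refl
zipWith-∧-update (a ∷ x) (l ∷ L) (suc e) b = cong (_ ∷_) (zipWith-∧-update x L e b)

act-live : ∀ {n m} (σ : Vec (Fin n) m) x L f y → lookup L f ≡ true →
  act σ (zipWith _∧_ x L) y ≡ flip (lookup x f) (lookup σ f) (act σ (zipWith _∧_ x (L [ f ]≔ false)) y)
act-live σ x L f y live rewrite zipWith-∧-remove x L f = trans (act-split σ (zipWith _∧_ x L) f y)
  (cong (λ b → flip b (lookup σ f) (act σ (zipWith _∧_ x L [ f ]≔ false) y))
    (trans (lookup-zipWith _∧_ f x L) (trans (cong (lookup x f ∧_) live) (∧-identityʳ _))))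

-- Only the coordinates in L are placed. A set Z of placements that works for all x in P at once and
-- has density at least δ^q; local lets a coordinate join L later.
record Abundant {m} (L : Vec Bool m) (P : Vec Bool m → Set) (q n : ℕ) (S : Vec Bool n → Bool) : Set where
  field
    Z     : Vec (Fin n) m → Vec Bool n → Bool
    local : ∀ e → lookup L e ≡ false → ∀ σ i y → Z (σ [ e ]≔ i) y ≡ Z σ y
    sound : ∀ σ y → Z σ y ≡ true → ∀ x → P x → S (act σ (zipWith _∧_ x L) y) ≡ true
    large : length (tuples n m) * length (allVecs n) * card S ^ q ≤
            ∑ (tuples n m) (λ σ → ∑ (allVecs n) (λ y → 𝟙 (Z σ y))) * length (allVecs n) ^ q

-- `q` is chosen before `n` and `S`, so that it can fix the exponent of the power saving.
Good : ∀ {m} → Vec Bool m → (Vec Bool m → Set) → Set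
Good L P = ∃[ q ] (1 ≤ q × (∀ n → 1 ≤ n → ∀ S → Abundant L P q n S))

-- Under an empty mask every placement sends all of `P` to the translation `y` itself, so `S` serves
-- as `Z`, and equality holds with `q = 1`.
good-none : ∀ {m} (L : Vec Bool m) P → (∀ e → lookup L e ≡ false) → Good L P
good-none {m} L P none = 1 , s≤s z≤n , λ n _ S → record
  { Z     = λ _ → S
  ; local = λ _ _ _ _ _ → refl
  ; sound = λ σ y Sy x _ → subst (λ u → S u ≡ true)
      (sym (trans (cong (λ u → act σ u y) (masked x L none)) (act-replicate-false σ y))) Sy
  ; large = ≤-reflexive (begin
      length (tuples n m) * length (allVecs n) * card S ^ 1
        ≡⟨ solve 3 (λ t l s → t :* l :* s := t :* s :* l) refl (length (tuples n m)) (length (allVecs n)) (card S ^ 1) ⟩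
      length (tuples n m) * card S ^ 1 * length (allVecs n)
        ≡⟨ cong₂ _*_ (trans (cong (length (tuples n m) *_) (*-identityʳ (card S))) (sym (∑-const (card S) (tuples n m)))) (sym (*-identityʳ _)) ⟩
      ∑ (tuples n m) (λ _ → ∑ (allVecs n) (λ y → 𝟙 (S y))) * length (allVecs n) ^ 1 ∎)
  }
  where
  open ≡-Reasoning
  open +-*-Solver
  masked : ∀ {m} (x L : Vec Bool m) → (∀ e → lookup L e ≡ false) → zipWith _∧_ x L ≡ replicate m false
  masked []      []      _    = refl
  masked (b ∷ x) (l ∷ L) none = cong₂ _∷_ (trans (cong (b ∧_) (none zero)) (∧-zeroʳ b)) (masked x L (none ∘ suc))

remove-false : ∀ {m} (L : Vec Bool m) f e → lookup L e ≡ false → lookup (L [ f ]≔ false) e ≡ false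
remove-false L f e dead with e ≟ f
... | yes refl = lookup∘update f L false
... | no  e≢f  = trans (lookup∘update′ e≢f L false) dead

true≢false : true ≢ false
true≢false ()

-- A constant value at `f` only translates the placement along the direction of `f`. Translating `y`
-- permutes the cube, so the count and `q` stay the same.
good-fixed : ∀ {m} (L : Vec Bool m) (P P′ : Vec Bool m → Set) f c → lookup L f ≡ true →
  (∀ x → P x → lookup x f ≡ c × P′ x) → Good (L [ f ]≔ false) P′ → Good L P
good-fixed {m} L P P′ f c live P⇒ (q , 1≤q , abundant) = q , 1≤q , λ n 1≤n S → extend n S (abundant n 1≤n S)
  where
  extend : ∀ n S → Abundant (L [ f ]≔ false) P′ q n S → Abundant L P q n S
  extend n S A = record
    { Z     = λ σ y → A.Z σ (flip c (lookup σ f) y)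
    ; local = λ e dead σ i y → trans
        (cong (λ j → A.Z (σ [ e ]≔ i) (flip c j y))
          (lookup∘update′ (λ f≡e → true≢false (trans (sym live) (trans (cong (lookup L) f≡e) dead))) σ i))
        (A.local e (remove-false L f e dead) σ i _)
    ; sound = λ σ y z x Px → let xf , P′x = P⇒ x Px in
        subst (λ u → S u ≡ true)
          (trans (sym (flip-act c (lookup σ f) σ _ y))
            (trans (cong (λ b → flip b (lookup σ f) (act σ (zipWith _∧_ x (L [ f ]≔ false)) y)) (sym xf))
              (sym (act-live σ x L f y live))))
          (A.sound σ _ z x P′x)
    ; large = ≤-trans A.large (≤-reflexive (cong (_* length (allVecs n) ^ q)
        (∑-cong (tuples n m) (λ σ → sym (∑-flip c (lookup σ f) (λ y → 𝟙 (A.Z σ y)))))))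
    }
    where module A = Abundant A

𝟙-∧ : ∀ a b → 𝟙 (a ∧ b) ≡ 𝟙 a * 𝟙 b
𝟙-∧ false b = refl
𝟙-∧ true  b = sym (+-identityʳ (𝟙 b))

∧-true : ∀ {a b} → a ∧ b ≡ true → a ≡ true × b ≡ true
∧-true {true} {true} _ = refl , refl

-- Fix the tuple apart from its e-th entry i. Then Z is a set of pairs (i , y), and Cauchy–Schwarz
-- counts the pairs of its elements with a common flip c i y; up to a translation of y these form Z².
module Duplicate {m} (e f : Fin m) (e≢f : e ≢ f) (c : Bool) (n : ℕ) (Z : Vec (Fin n) m → Vec Bool n → Bool)
  (Z-local : ∀ σ i y → Z (σ [ f ]≔ i) y ≡ Z σ y) where

  -- The first factor handles the points with value `c` at `f`, which the translation absorbs. The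
  -- second handles those with `not c` at `f` and `c` at `e`: the direction of `f` takes the place
  -- of that of `e`, and the translation absorbs the direction of `e`.
  Z² : Vec (Fin n) m → Vec Bool n → Bool
  Z² σ y = Z σ (flip c (lookup σ f) y) ∧ Z (σ [ e ]≔ lookup σ f) (flip c (lookup σ e) y)

  size : (Vec (Fin n) m → Vec Bool n → Bool) → ℕ
  size W = ∑ (tuples n m) (λ σ → ∑ (allVecs n) (λ y → 𝟙 (W σ y)))

  slice : Vec (Fin n) m → Vec Bool n → ℕ
  slice σ y = ∑ (allFin n) (λ i → 𝟙 (Z (σ [ e ]≔ i) (flip c i y)))

  ∑-slice : ∑ (tuples n m) (λ σ → ∑ (allVecs n) (slice σ)) ≡ n * size Z
  ∑-slice = begin
    ∑ (tuples n m) (λ σ → ∑ (allVecs n) (slice σ))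
      ≡⟨ ∑-cong (tuples n m) (λ σ → ∑-swap (allVecs n) (allFin n) _) ⟩
    ∑ (tuples n m) (λ σ → ∑ (allFin n) (λ i → ∑ (allVecs n) (λ y → 𝟙 (Z (σ [ e ]≔ i) (flip c i y)))))
      ≡⟨ ∑-cong (tuples n m) (λ σ → ∑-cong (allFin n) (λ i → ∑-flip c i _)) ⟩
    ∑ (tuples n m) (λ σ → ∑ (allFin n) (λ i → ∑ (allVecs n) (λ y → 𝟙 (Z (σ [ e ]≔ i) y))))
      ≡⟨ ∑-resample e (λ σ → ∑ (allVecs n) (λ y → 𝟙 (Z σ y))) ⟩
    n * size Z ∎
    where open ≡-Reasoning

  -- Translating by both flips cancels one of them in each factor, and `Z-local` drops the entry at
  -- `f`. For given `σ` and `y` one factor depends on `i` only and the other on `j` only, so the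
  -- double sum is the square of `slice`.
  Z²-resampled : ∀ σ i j y → 𝟙 (Z² ((σ [ e ]≔ i) [ f ]≔ j) (flip c i (flip c j y))) ≡
    𝟙 (Z (σ [ e ]≔ i) (flip c i y)) * 𝟙 (Z (σ [ e ]≔ j) (flip c j y))
  Z²-resampled σ i j y = trans (𝟙-∧ (Z τ _) _) (cong₂ (λ a b → 𝟙 a * 𝟙 b) first second)
    where
    open ≡-Reasoning
    τ = (σ [ e ]≔ i) [ f ]≔ j
    τf : lookup τ f ≡ j
    τf = lookup∘update f (σ [ e ]≔ i) j
    τe : lookup τ e ≡ i
    τe = trans (lookup∘update′ e≢f (σ [ e ]≔ i) j) (lookup∘update e σ i)
    first : Z τ (flip c (lookup τ f) (flip c i (flip c j y))) ≡ Z (σ [ e ]≔ i) (flip c i y)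
    first = begin
      Z τ (flip c (lookup τ f) (flip c i (flip c j y)))  ≡⟨ cong (λ k → Z τ (flip c k (flip c i (flip c j y)))) τf ⟩
      Z τ (flip c j (flip c i (flip c j y)))  ≡⟨ cong (Z τ ∘ flip c j) (flip-comm c c i j y) ⟩
      Z τ (flip c j (flip c j (flip c i y)))  ≡⟨ cong (Z τ) (flip-involutive c j _) ⟩
      Z τ (flip c i y)  ≡⟨ Z-local (σ [ e ]≔ i) j _ ⟩
      Z (σ [ e ]≔ i) (flip c i y) ∎
    second : Z (τ [ e ]≔ lookup τ f) (flip c (lookup τ e) (flip c i (flip c j y))) ≡ Z (σ [ e ]≔ j) (flip c j y)
    second = begin
      Z (τ [ e ]≔ lookup τ f) (flip c (lookup τ e) (flip c i (flip c j y)))  ≡⟨ cong₂ (λ k l → Z (τ [ e ]≔ k) (flip c l (flip c i (flip c j y)))) τf τe ⟩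
      Z (τ [ e ]≔ j) (flip c i (flip c i (flip c j y)))  ≡⟨ cong (Z (τ [ e ]≔ j)) (flip-involutive c i _) ⟩
      Z (τ [ e ]≔ j) (flip c j y)  ≡⟨ cong (λ ρ → Z ρ (flip c j y)) ([]≔-commutes (σ [ e ]≔ i) f e (e≢f ∘ sym)) ⟩
      Z (((σ [ e ]≔ i) [ e ]≔ j) [ f ]≔ j) (flip c j y)  ≡⟨ Z-local _ j _ ⟩
      Z ((σ [ e ]≔ i) [ e ]≔ j) (flip c j y)  ≡⟨ cong (λ ρ → Z ρ (flip c j y)) ([]≔-idempotent σ e) ⟩
      Z (σ [ e ]≔ j) (flip c j y) ∎

  ∑-slice² : ∑ (tuples n m) (λ σ → ∑ (allVecs n) (λ y → slice σ y * slice σ y)) ≡ n * (n * size Z²)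
  ∑-slice² = begin
    ∑T (λ σ → ∑ (allVecs n) (λ y → slice σ y * slice σ y))
      ≡⟨ ∑-cong (tuples n m) (λ σ → ∑-cong (allVecs n) (λ y → sym (∑-*-∑ (allFin n) (allFin n) _ _))) ⟩
    ∑T (λ σ → ∑ (allVecs n) (λ y → ∑F (λ i → ∑F (λ j → 𝟙 (Z (σ [ e ]≔ i) (flip c i y)) * 𝟙 (Z (σ [ e ]≔ j) (flip c j y))))))
      ≡⟨ ∑-cong (tuples n m) (λ σ → ∑-cong (allVecs n) (λ y → ∑-cong (allFin n) (λ i → ∑-cong (allFin n) (λ j → sym (Z²-resampled σ i j y))))) ⟩
    ∑T (λ σ → ∑ (allVecs n) (λ y → ∑F (λ i → ∑F (λ j → 𝟙 (Z² ((σ [ e ]≔ i) [ f ]≔ j) (flip c i (flip c j y)))))))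
      ≡⟨ ∑-cong (tuples n m) (λ σ → trans (∑-swap (allVecs n) (allFin n) _) (∑-cong (allFin n) (λ i → ∑-swap (allVecs n) (allFin n) _))) ⟩
    ∑T (λ σ → ∑F (λ i → ∑F (λ j → ∑ (allVecs n) (λ y → 𝟙 (Z² ((σ [ e ]≔ i) [ f ]≔ j) (flip c i (flip c j y)))))))
      ≡⟨ ∑-cong (tuples n m) (λ σ → ∑-cong (allFin n) (λ i → ∑-cong (allFin n) (λ j →
           trans (∑-flip c j (λ y → 𝟙 (Z² ((σ [ e ]≔ i) [ f ]≔ j) (flip c i y)))) (∑-flip c i _)))) ⟩
    ∑T (λ σ → ∑F (λ i → ∑F (λ j → ∑ (allVecs n) (λ y → 𝟙 (Z² ((σ [ e ]≔ i) [ f ]≔ j) y)))))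
      ≡⟨ ∑-resample e (λ σ → ∑F (λ j → ∑ (allVecs n) (λ y → 𝟙 (Z² (σ [ f ]≔ j) y)))) ⟩
    n * ∑T (λ σ → ∑F (λ j → ∑ (allVecs n) (λ y → 𝟙 (Z² (σ [ f ]≔ j) y))))
      ≡⟨ cong (n *_) (∑-resample f (λ σ → ∑ (allVecs n) (λ y → 𝟙 (Z² σ y)))) ⟩
    n * (n * size Z²) ∎
    where
    open ≡-Reasoning
    ∑T = ∑ (tuples n m)
    ∑F = ∑ (allFin n)

  -- Cauchy-Schwarz for `slice` over all pairs of a tuple and a translation. Resampling has put a
  -- factor `n * n` on both sides; cancelling it uses `1 ≤ n`.
  size-Z² : 1 ≤ n → size Z * size Z ≤ length (tuples n m) * length (allVecs n) * size Z²
  size-Z² (s≤s {n = n′} _) = *-cancelˡ-≤ n (*-cancelˡ-≤ n (begin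
    n * (n * (size Z * size Z))     ≡⟨ solve 2 (λ n z → n :* (n :* (z :* z)) := (n :* z) :* (n :* z)) refl n (size Z) ⟩
    (n * size Z) * (n * size Z)     ≡⟨ cong₂ _*_ ∑-slice ∑-slice ⟨
    ∑ (tuples n m) (λ σ → ∑ (allVecs n) (slice σ)) * ∑ (tuples n m) (λ σ → ∑ (allVecs n) (slice σ))
                                    ≤⟨ cauchy-schwarz₂ (tuples n m) (allVecs n) slice ⟩
    M * ∑ (tuples n m) (λ σ → ∑ (allVecs n) (λ y → slice σ y * slice σ y))  ≡⟨ cong (M *_) ∑-slice² ⟩
    M * (n * (n * size Z²))         ≡⟨ solve 3 (λ n M z → M :* (n :* (n :* z)) := n :* (n :* (M :* z))) refl n M (size Z²) ⟩
    n * (n * (M * size Z²))         ∎))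
    where
    open ≤-Reasoning
    open +-*-Solver
    M = length (tuples n m) * length (allVecs n)

length-tuples : ∀ n m → length (tuples n m) ≡ n ^ m
length-tuples n zero    = refl
length-tuples n (suc m) = begin
  length (tuples n (suc m))                ≡⟨ *-identityʳ _ ⟨
  length (tuples n (suc m)) * 1            ≡⟨ ∑-const 1 (tuples n (suc m)) ⟨
  ∑ (tuples n (suc m)) (λ _ → 1)           ≡⟨ ∑-tuples {n} {m} (λ _ → 1) ⟩
  ∑ (allFin n) (λ _ → ∑ (tuples n m) (λ _ → 1))  ≡⟨ ∑-allFin-const n _ ⟩
  n * ∑ (tuples n m) (λ _ → 1)             ≡⟨ cong (n *_) (trans (∑-const 1 (tuples n m)) (*-identityʳ _)) ⟩
  n * length (tuples n m)                  ≡⟨ cong (n *_) (length-tuples n m) ⟩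
  n * n ^ m                                ∎
  where open ≡-Reasoning

total-nonZero : ∀ n m → 1 ≤ n → NonZero (length (tuples n m) * length (allVecs n))
total-nonZero (suc n) m _ rewrite length-tuples (suc n) m | length-allVecs (suc n) =
  m*n≢0 _ _ {{m^n≢0 (suc n) m}} {{m^n≢0 2 (suc n)}}

-- The values at `e` and `f` under `P` double the value at `e` under `P′`: `c` becomes `c , c`,
-- while `not c` becomes `not c , c` or `c , not c`. Parallel edges are the case of `c` false,
-- subdivisions that of `c` true. The lower bound on the density is squared, so `q` doubles.
good-duplicate : ∀ {m} (L : Vec Bool m) (P P′ : Vec Bool m → Set) e f c → e ≢ f →
  lookup L e ≡ true → lookup L f ≡ true →
  (∀ x → P x → (lookup x f ≡ c × P′ x) ⊎
    (lookup x f ≡ not c × lookup x e ≡ c × P′ ((x [ e ]≔ not c) [ f ]≔ c))) →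
  Good (L [ f ]≔ false) P′ → Good L P
good-duplicate {m} L P P′ e f c e≢f e-live f-live P⇒ (q , 1≤q , abundant) =
  q + q , ≤-trans 1≤q (m≤m+n q q) , λ n 1≤n S → extend n 1≤n S (abundant n 1≤n S)
  where
  extend : ∀ n → 1 ≤ n → ∀ S → Abundant (L [ f ]≔ false) P′ q n S → Abundant L P (q + q) n S
  extend n 1≤n S A = record { Z = Z² ; local = Z²-local ; sound = Z²-sound ; large = Z²-large }
    where
    module A = Abundant A
    open Duplicate e f e≢f c n A.Z (A.local f (lookup∘update f L false))
    L′ = L [ f ]≔ false

    live≢dead : ∀ {k g} → lookup L k ≡ true → lookup L g ≡ false → k ≢ g
    live≢dead live dead refl = true≢false (trans (sym live) dead)

    Z²-local : ∀ g → lookup L g ≡ false → ∀ σ i y → Z² (σ [ g ]≔ i) y ≡ Z² σ y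
    Z²-local g dead σ i y = cong₂ _∧_
      (trans (cong (λ k → A.Z (σ [ g ]≔ i) (flip c k y)) σf) (A.local g g-dead σ i _))
      (trans (cong₂ (λ k l → A.Z ((σ [ g ]≔ i) [ e ]≔ k) (flip c l y)) σf σe)
        (trans (cong (λ τ → A.Z τ (flip c (lookup σ e) y)) ([]≔-commutes σ g e (live≢dead e-live dead ∘ sym)))
          (A.local g g-dead _ i _)))
      where
      g-dead = remove-false L f g dead
      σf = lookup∘update′ (live≢dead f-live dead) σ i
      σe = lookup∘update′ (live≢dead e-live dead) σ i

    Z²-sound : ∀ σ y → Z² σ y ≡ true → ∀ x → P x → S (act σ (zipWith _∧_ x L) y) ≡ true
    Z²-sound σ y z x Px with ∧-true z | P⇒ x Px
    ... | z₁ , _ | inj₁ (xf , P′x) = subst (λ u → S u ≡ true)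
          (trans (sym (flip-act c (lookup σ f) σ _ y))
            (trans (cong (λ b → flip b (lookup σ f) (act σ (zipWith _∧_ x L′) y)) (sym xf))
              (sym (act-live σ x L f y f-live))))
          (A.sound σ _ z₁ x P′x)
    ... | _ , z₂ | inj₂ (xf , xe , P′x′) = subst (λ u → S u ≡ true) (sym eq) (A.sound _ _ z₂ x′ P′x′)
      where
      open ≡-Reasoning
      x′ = (x [ e ]≔ not c) [ f ]≔ c
      τ = σ [ e ]≔ lookup σ f
      u = (zipWith _∧_ x L [ f ]≔ false) [ e ]≔ false
      e-live′ : lookup L′ e ≡ true
      e-live′ = trans (lookup∘update′ e≢f L false) e-live
      x′e : lookup x′ e ≡ not c
      x′e = trans (lookup∘update′ e≢f (x [ e ]≔ not c) c) (lookup∘update e x (not c))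
      u-x : zipWith _∧_ x (L′ [ e ]≔ false) ≡ u
      u-x = trans (zipWith-∧-remove x L′ e) (cong (_[ e ]≔ false) (zipWith-∧-remove x L f))
      u-x′ : zipWith _∧_ x′ (L′ [ e ]≔ false) ≡ u
      u-x′ = begin
        zipWith _∧_ x′ (L′ [ e ]≔ false)
          ≡⟨ trans (zipWith-∧-remove x′ L′ e) (cong (_[ e ]≔ false) (zipWith-∧-remove x′ L f)) ⟩
        (zipWith _∧_ x′ L [ f ]≔ false) [ e ]≔ false
          ≡⟨ cong (λ v → (v [ f ]≔ false) [ e ]≔ false) (trans (zipWith-∧-update (x [ e ]≔ not c) L f c)
               (cong (_[ f ]≔ _) (zipWith-∧-update x L e (not c)))) ⟩
        (((zipWith _∧_ x L [ e ]≔ _) [ f ]≔ _) [ f ]≔ false) [ e ]≔ false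
          ≡⟨ cong (_[ e ]≔ false) ([]≔-idempotent _ f) ⟩
        ((zipWith _∧_ x L [ e ]≔ _) [ f ]≔ false) [ e ]≔ false
          ≡⟨ []≔-commutes _ f e (e≢f ∘ sym) ⟩
        ((zipWith _∧_ x L [ e ]≔ _) [ e ]≔ false) [ f ]≔ false
          ≡⟨ cong (_[ f ]≔ false) ([]≔-idempotent _ e) ⟩
        (zipWith _∧_ x L [ e ]≔ false) [ f ]≔ false
          ≡⟨ []≔-commutes _ e f e≢f ⟩
        u ∎
      u-resample : act τ u y ≡ act σ u y
      u-resample = act-resample σ _ e (lookup σ f) y
      eq : act σ (zipWith _∧_ x L) y ≡ act τ (zipWith _∧_ x′ L′) (flip c (lookup σ e) y)
      eq = begin
        act σ (zipWith _∧_ x L) y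
          ≡⟨ trans (act-live σ x L f y f-live) (cong (flip _ _) (act-live σ x L′ e y e-live′)) ⟩
        flip (lookup x f) (lookup σ f) (flip (lookup x e) (lookup σ e) (act σ (zipWith _∧_ x (L′ [ e ]≔ false)) y))
          ≡⟨ cong₂ (λ a b → flip a (lookup σ f) (flip b (lookup σ e) (act σ (zipWith _∧_ x (L′ [ e ]≔ false)) y))) xf xe ⟩
        flip (not c) (lookup σ f) (flip c (lookup σ e) (act σ (zipWith _∧_ x (L′ [ e ]≔ false)) y))
          ≡⟨ cong (flip (not c) (lookup σ f) ∘ flip c (lookup σ e)) (trans (cong (λ v → act σ v y) u-x) (sym u-resample)) ⟩
        flip (not c) (lookup σ f) (flip c (lookup σ e) (act τ u y))
          ≡⟨ cong (flip (not c) (lookup σ f)) (flip-act c (lookup σ e) τ u y) ⟩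
        flip (not c) (lookup σ f) (act τ u (flip c (lookup σ e) y))
          ≡⟨ cong₂ (λ b i → flip b i (act τ u (flip c (lookup σ e) y))) x′e (lookup∘update e σ _) ⟨
        flip (lookup x′ e) (lookup τ e) (act τ u (flip c (lookup σ e) y))
          ≡⟨ cong (λ v → flip (lookup x′ e) (lookup τ e) (act τ v (flip c (lookup σ e) y))) u-x′ ⟨
        flip (lookup x′ e) (lookup τ e) (act τ (zipWith _∧_ x′ (L′ [ e ]≔ false)) (flip c (lookup σ e) y))
          ≡⟨ act-live τ x′ L′ e _ e-live′ ⟨
        act τ (zipWith _∧_ x′ L′) (flip c (lookup σ e) y) ∎

    Z²-large : length (tuples n m) * length (allVecs n) * card S ^ (q + q) ≤ size Z² * length (allVecs n) ^ (q + q)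
    -- The extra factor `M` makes the left side the square of the left side of `A.large`.
    Z²-large = *-cancelˡ-≤ M {{total-nonZero n m 1≤n}} (begin
      M * (M * s ^ (q + q))               ≡⟨ cong (λ k → M * (M * k)) (^-distribˡ-+-* s q q) ⟩
      M * (M * (s ^ q * s ^ q))           ≡⟨ solve 2 (λ M a → M :* (M :* (a :* a)) := (M :* a) :* (M :* a)) refl M (s ^ q) ⟩
      (M * s ^ q) * (M * s ^ q)           ≤⟨ *-mono-≤ A.large A.large ⟩
      (z * N ^ q) * (z * N ^ q)           ≡⟨ solve 2 (λ z k → (z :* k) :* (z :* k) := z :* z :* (k :* k)) refl z (N ^ q) ⟩
      z * z * (N ^ q * N ^ q)             ≤⟨ *-monoˡ-≤ (N ^ q * N ^ q) (size-Z² 1≤n) ⟩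
      M * size Z² * (N ^ q * N ^ q)       ≡⟨ cong (M * size Z² *_) (^-distribˡ-+-* N q q) ⟨
      M * size Z² * N ^ (q + q)           ≡⟨ *-assoc M (size Z²) _ ⟩
      M * (size Z² * N ^ (q + q))         ∎)
      where
      open ≤-Reasoning
      open +-*-Solver
      N = length (allVecs n)
      M = length (tuples n m) * N
      s = card S
      z = size A.Z

-- Placements with distinct directions are embeddings

occurrences : ∀ {n m} → Fin n → Vec (Fin n) m → ℕ
occurrences i []      = 0
occurrences i (j ∷ σ) = 𝟙 ⌊ i ≟ j ⌋ + occurrences i σ

-- Counts the pairs of positions with equal entries. It vanishes exactly for distinct directions and
-- dominates the indicator of degeneracy, yet is easy to sum.
repeats : ∀ {n m} → Vec (Fin n) m → ℕ
repeats []      = 0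
repeats (i ∷ σ) = occurrences i σ + repeats σ

∑-𝟙-≟ : ∀ {n} (j : Fin n) → ∑ (allFin n) (λ i → 𝟙 ⌊ i ≟ j ⌋) ≡ 1
∑-𝟙-≟ {suc n} zero    = cong suc (trans
  (cong sum (trans (map-tabulate {n = n} suc (λ i → 𝟙 ⌊ i ≟ zero ⌋)) (sym (map-tabulate {n = n} (λ i → i) (λ _ → 0)))))
  (trans (∑-allFin-const n 0) (*-zeroʳ n)))
∑-𝟙-≟ {suc n} (suc j) = trans
  (cong sum (trans (map-tabulate {n = n} suc (λ i → 𝟙 ⌊ i ≟ suc j ⌋)) (sym (map-tabulate {n = n} (λ i → i) (λ i → 𝟙 ⌊ suc i ≟ suc j ⌋)))))
  (trans (∑-cong (allFin n) suc-≟) (∑-𝟙-≟ j))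
  where
  suc-≟ : ∀ i → 𝟙 ⌊ suc i ≟ suc j ⌋ ≡ 𝟙 ⌊ i ≟ j ⌋
  suc-≟ i with i ≟ j
  ... | yes _ = refl
  ... | no  _ = refl

∑-occurrences : ∀ {n m} (σ : Vec (Fin n) m) → ∑ (allFin n) (λ i → occurrences i σ) ≡ m
∑-occurrences {n}         []      = trans (∑-allFin-const n 0) (*-zeroʳ n)
∑-occurrences {n} {suc m} (j ∷ σ) =
  trans (∑-+ (allFin n) (λ i → 𝟙 ⌊ i ≟ j ⌋) (λ i → occurrences i σ)) (cong₂ _+_ (∑-𝟙-≟ j) (∑-occurrences σ))

-- Each pair of positions coincides in one out of `n` tuples, and `m * m` is a convenient upper
-- bound for the number of pairs.
∑-repeats : ∀ n m → n * ∑ (tuples n m) repeats ≤ m * m * length (tuples n m)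
∑-repeats n zero    = ≤-reflexive (*-zeroʳ n)
∑-repeats n (suc m) = begin
  n * ∑ (tuples n (suc m)) repeats
    ≡⟨ cong (n *_) (trans (∑-tuples {n} {m} repeats) (trans (∑-cong (allFin n) (λ i → ∑-+ (tuples n m) (occurrences i) repeats))
         (∑-+ (allFin n) (λ i → ∑ (tuples n m) (occurrences i)) (λ _ → R)))) ⟩
  n * (∑ (allFin n) (λ i → ∑ (tuples n m) (occurrences i)) + ∑ (allFin n) (λ _ → R))
    ≡⟨ cong (n *_) (cong₂ _+_
         (trans (∑-swap (allFin n) (tuples n m) occurrences) (trans (∑-cong (tuples n m) ∑-occurrences) (∑-const m (tuples n m))))
         (∑-allFin-const n R)) ⟩
  n * (l * m + n * R)
    ≤⟨ *-monoʳ-≤ n (+-monoʳ-≤ (l * m) (∑-repeats n m)) ⟩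
  n * (l * m + m * m * l)
    ≤⟨ m≤m+n _ (n * ((1 + m) * l)) ⟩
  n * (l * m + m * m * l) + n * ((1 + m) * l)
    ≡⟨ solve 3 (λ n m l → n :* (l :* m :+ m :* m :* l) :+ n :* ((con 1 :+ m) :* l) := (con 1 :+ m) :* (con 1 :+ m) :* (n :* l)) refl n m l ⟩
  suc m * suc m * (n * l)
    ≡⟨ cong (suc m * suc m *_) (trans (cong (n *_) (length-tuples n m)) (sym (length-tuples n (suc m)))) ⟩
  suc m * suc m * length (tuples n (suc m)) ∎
  where
  open ≤-Reasoning
  open +-*-Solver
  R = ∑ (tuples n m) repeats
  l = length (tuples n m)

lookup-flip : ∀ {n} b (i : Fin n) y → lookup (flip b i y) i ≡ b xor lookup y i
lookup-flip b zero    (x ∷ y) = refl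
lookup-flip b (suc i) (x ∷ y) = lookup-flip b i y

lookup-flip′ : ∀ {n} b (i j : Fin n) y → i ≢ j → lookup (flip b i y) j ≡ lookup y j
lookup-flip′ b zero    zero    (x ∷ y) i≢j = ⊥-elim (i≢j refl)
lookup-flip′ b zero    (suc j) (x ∷ y) i≢j = refl
lookup-flip′ b (suc i) zero    (x ∷ y) i≢j = refl
lookup-flip′ b (suc i) (suc j) (x ∷ y) i≢j = lookup-flip′ b i j y (i≢j ∘ cong suc)

lookup-act-fresh : ∀ {n m} (σ : Vec (Fin n) m) x y i → occurrences i σ ≡ 0 → lookup (act σ x y) i ≡ lookup y i
lookup-act-fresh []      []      y i fresh = refl
lookup-act-fresh (j ∷ σ) (b ∷ x) y i fresh with i ≟ j
... | no i≢j = trans (lookup-flip′ b j i _ (i≢j ∘ sym)) (lookup-act-fresh σ x y i fresh)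

hamming-flip : ∀ {n} a b (i : Fin n) u w → lookup u i ≡ lookup w i →
  hamming (flip a i u) (flip b i w) ≡ 𝟙 (a xor b) + hamming u w
hamming-flip a b zero (x ∷ u) (.x ∷ w) refl = cong₂ (λ c d → 𝟙 c + (𝟙 d + hamming u w)) (cancel a b x) (sym (xor-same x))
  where
  cancel : ∀ a b x → (a xor x) xor (b xor x) ≡ a xor b
  cancel false false x     = xor-same x
  cancel false true  false = refl
  cancel false true  true  = refl
  cancel true  false false = refl
  cancel true  false true  = refl
  cancel true  true  x     = xor-same (not x)
hamming-flip a b (suc i) (x ∷ u) (y ∷ w) eq = begin
  𝟙 (x xor y) + hamming (flip a i u) (flip b i w)  ≡⟨ cong (𝟙 (x xor y) +_) (hamming-flip a b i u w eq) ⟩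
  𝟙 (x xor y) + (𝟙 (a xor b) + hamming u w)        ≡⟨ solve 3 (λ p q r → p :+ (q :+ r) := q :+ (p :+ r)) refl (𝟙 (x xor y)) (𝟙 (a xor b)) (hamming u w) ⟩
  𝟙 (a xor b) + (𝟙 (x xor y) + hamming u w)        ∎
  where
  open ≡-Reasoning
  open +-*-Solver

hamming-self : ∀ {n} (x : Vec Bool n) → hamming x x ≡ 0
hamming-self []      = refl
hamming-self (b ∷ x) = cong₂ (λ c d → 𝟙 c + d) (xor-same b) (hamming-self x)

hamming≡0⇒≡ : ∀ {n} (x y : Vec Bool n) → hamming x y ≡ 0 → x ≡ y
hamming≡0⇒≡ []          []          _  = refl
hamming≡0⇒≡ (false ∷ x) (false ∷ y) eq = cong (false ∷_) (hamming≡0⇒≡ x y eq)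
hamming≡0⇒≡ (true ∷ x)  (true ∷ y)  eq = cong (true ∷_) (hamming≡0⇒≡ x y eq)

-- Distinct directions never interfere, so the placement is an isometry. Injectivity and both
-- adjacency conditions of an embedding follow from this.
hamming-act : ∀ {n m} (σ : Vec (Fin n) m) → repeats σ ≡ 0 → ∀ x z y → hamming (act σ x y) (act σ z y) ≡ hamming x z
hamming-act []      distinct []      []      y = hamming-self y
hamming-act (i ∷ σ) distinct (a ∷ x) (b ∷ z) y = trans
  (hamming-flip a b i (act σ x y) (act σ z y) (trans (lookup-act-fresh σ x y i fresh) (sym (lookup-act-fresh σ z y i fresh))))
  (cong (𝟙 (a xor b) +_) (hamming-act σ (m+n≡0⇒n≡0 (occurrences i σ) distinct) x z y))
  where fresh = m+n≡0⇒m≡0 (occurrences i σ) distinct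

-- Meant as the characteristic vector of the set of directions, obtained by flipping each of them in
-- the zero vector. It is that for distinct directions; repeated ones would cancel.
directions : ∀ {n m} → Vec (Fin n) m → Vec Bool n
directions {n} {m} σ = act σ (replicate m true) (replicate n false)

directions-fresh : ∀ {n m} (i : Fin n) (σ : Vec (Fin n) m) → occurrences i σ ≡ 0 → lookup (directions σ) i ≡ false
directions-fresh {n} {m} i σ fresh =
  trans (lookup-act-fresh σ (replicate m true) (replicate n false) i fresh) (lookup-replicate i false)

lookup-directions : ∀ {n m} (i : Fin n) (σ : Vec (Fin n) m) → occurrences i σ ≡ 0 → lookup (directions (i ∷ σ)) i ≡ true
lookup-directions i σ fresh = trans (lookup-flip true i (directions σ)) (cong not (directions-fresh i σ fresh))

countTrue-flip : ∀ {n} (i : Fin n) u → lookup u i ≡ false → countTrue (flip true i u) ≡ suc (countTrue u)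
countTrue-flip zero    (false ∷ u) _  = refl
countTrue-flip (suc i) (b ∷ u)     ui = trans (cong (𝟙 b +_) (countTrue-flip i u ui)) (+-suc (𝟙 b) (countTrue u))

countTrue-replicate-false : ∀ n → countTrue (replicate n false) ≡ 0
countTrue-replicate-false zero    = refl
countTrue-replicate-false (suc n) = countTrue-replicate-false n

countTrue-directions : ∀ {n m} (σ : Vec (Fin n) m) → repeats σ ≡ 0 → countTrue (directions σ) ≡ m
countTrue-directions {n} []      distinct = countTrue-replicate-false n
countTrue-directions     (i ∷ σ) distinct = trans
  (countTrue-flip i (directions σ) (directions-fresh i σ (m+n≡0⇒m≡0 (occurrences i σ) distinct)))
  (cong suc (countTrue-directions σ (m+n≡0⇒n≡0 (occurrences i σ) distinct)))

AgreeOff : ∀ {n m} → Vec (Fin n) m → Vec Bool n → Vec Bool n → Set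
AgreeOff σ y z = ∀ j → lookup (directions σ) j ≡ false → lookup z j ≡ lookup y j

act-agree : ∀ {n m} (σ : Vec (Fin n) m) → repeats σ ≡ 0 → ∀ x y → AgreeOff σ y (act σ x y)
act-agree []      distinct []      y j _   = refl
act-agree (i ∷ σ) distinct (b ∷ x) y j off with i ≟ j
... | yes refl = ⊥-elim (true≢false (trans (sym (lookup-directions i σ (m+n≡0⇒m≡0 (occurrences i σ) distinct))) off))
... | no i≢j   = trans (lookup-flip′ b i j _ i≢j)
  (act-agree σ (m+n≡0⇒n≡0 (occurrences i σ) distinct) x y j (trans (sym (lookup-flip′ true i j _ i≢j)) off))

act-onto : ∀ {n m} (σ : Vec (Fin n) m) → repeats σ ≡ 0 → ∀ y z → AgreeOff σ y z → ∃[ x ] act σ x y ≡ z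
act-onto [] distinct y z agree =
  [] , Pointwise-≡⇒≡ (ext (λ j → sym (agree j (lookup-replicate j false))))
act-onto (i ∷ σ) distinct y z agree =
  let x , eq = act-onto σ (m+n≡0⇒n≡0 (occurrences i σ) distinct) y (flip b i z) agree′
  in b ∷ x , trans (cong (flip b i) eq) (flip-involutive b i z)
  where
  -- The only value that carries `y` to `z` at `i`, since no other direction touches this
  -- coordinate.
  b = lookup z i xor lookup y i
  xor-cancel : ∀ a c → (a xor c) xor a ≡ c
  xor-cancel false c     = xor-identityʳ c
  xor-cancel true  false = refl
  xor-cancel true  true  = refl
  agree′ : AgreeOff σ y (flip b i z)
  agree′ j off with i ≟ j
  ... | yes refl = trans (lookup-flip b i z) (xor-cancel (lookup z i) (lookup y i))
  ... | no i≢j   = trans (lookup-flip′ b i j z i≢j) (agree j (trans (lookup-flip′ true i j _ i≢j) off))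

act-embedding : ∀ {n m} (σ : Vec (Fin n) m) → repeats σ ≡ 0 → Vec Bool n → Embedding m n
act-embedding σ distinct y = record
  { ψ         = λ x → act σ x y
  ; injective = λ x z eq → hamming≡0⇒≡ x z (trans (sym (hamming-act σ distinct x z y))
      (trans (cong (λ u → hamming u (act σ z y)) eq) (hamming-self (act σ z y))))
  ; adj→      = λ x z → trans (hamming-act σ distinct x z y)
  ; adj←      = λ x z → trans (sym (hamming-act σ distinct x z y))
  ; face      = record { free = directions σ ; dim = countTrue-directions σ distinct ; base = y }
  ; into      = λ x → act-agree σ distinct x y
  ; onto      = act-onto σ distinct y
  }

-- If `S` contains no embedded copy of `Y`, every placement in `Z` repeats a direction, so `Z` has
-- density at most `m * m / n`, against at least the `q`-th power of the density of `S`. The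
-- conclusion is the bound with ε = p / q, cleared of roots and denominators.
good⇒power-saving : ∀ {m} (Y P : Vec Bool m → Set) → (∀ x → Y x → P x) → Good (replicate m true) P →
  ∃[ p ] ∃[ q ] ∃[ C ] ∃[ N ] (1 ≤ p × 1 ≤ q ×
    (∀ (n : ℕ) → N ≤ n → ∀ (S : Vec Bool n → Bool) → XFree {m} {n} Y S → card S ^ q * n ^ p ≤ C * 2 ^ (n * q)))
good⇒power-saving {m} Y P Y⇒P (q , 1≤q , abundant) =
  -- `m * m` is the constant of `∑-repeats`, and goodness speaks of `n` from 1 on.
  1 , q , m * m , 1 , s≤s z≤n , 1≤q , λ n 1≤n S free → bound n 1≤n S free (abundant n 1≤n S)
  where
  all-live : ∀ {m} (x : Vec Bool m) → zipWith _∧_ x (replicate m true) ≡ x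
  all-live []      = refl
  all-live (b ∷ x) = cong₂ _∷_ (∧-identityʳ b) (all-live x)

  bound : ∀ n → 1 ≤ n → ∀ S → XFree Y S → Abundant (replicate m true) P q n S →
    card S ^ q * n ^ 1 ≤ m * m * 2 ^ (n * q)
  bound n 1≤n S free A = *-cancelˡ-≤ (T * N) {{total-nonZero n m 1≤n}} (begin
    T * N * (s ^ q * n ^ 1)        ≡⟨ solve 3 (λ M a n → M :* (a :* (n :* con 1)) := n :* (M :* a)) refl (T * N) (s ^ q) n ⟩
    n * (T * N * s ^ q)            ≤⟨ *-monoʳ-≤ n A.large ⟩
    n * (size * N ^ q)             ≤⟨ *-monoʳ-≤ n (*-monoˡ-≤ (N ^ q) size≤) ⟩
    n * (R * N * N ^ q)            ≡⟨ solve 4 (λ n R N k → n :* (R :* N :* k) := n :* R :* (N :* k)) refl n R N (N ^ q) ⟩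
    n * R * (N * N ^ q)            ≤⟨ *-monoˡ-≤ (N * N ^ q) (∑-repeats n m) ⟩
    m * m * T * (N * N ^ q)        ≡⟨ solve 4 (λ c T N k → c :* T :* (N :* k) := T :* N :* (c :* k)) refl (m * m) T N (N ^ q) ⟩
    T * N * (m * m * N ^ q)        ≡⟨ cong (λ k → T * N * (m * m * k)) (trans (cong (_^ q) (length-allVecs n)) (^-*-assoc 2 n q)) ⟩
    T * N * (m * m * 2 ^ (n * q))  ∎)
    where
    open ≤-Reasoning
    open +-*-Solver
    module A = Abundant A
    T = length (tuples n m)
    N = length (allVecs n)
    s = card S
    R = ∑ (tuples n m) repeats
    size = ∑ (tuples n m) (λ σ → ∑ (allVecs n) (λ y → 𝟙 (A.Z σ y)))
    𝟙≤repeats : ∀ σ y → 𝟙 (A.Z σ y) ≤ repeats σ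
    𝟙≤repeats σ y with A.Z σ y in z | repeats σ in r
    ... | false | _     = z≤n
    ... | true  | suc _ = s≤s z≤n
    ... | true  | zero  = ⊥-elim (free (act-embedding σ r y) (λ x Yx →
      subst (λ u → S (act σ u y) ≡ true) (all-live x) (A.sound σ y z x (Y⇒P x Yx))))
    size≤ : size ≤ R * N
    size≤ = begin
      size                                                 ≤⟨ ∑-mono (tuples n m) (λ σ → ∑-mono (allVecs n) (𝟙≤repeats σ)) ⟩
      ∑ (tuples n m) (λ σ → ∑ (allVecs n) (λ _ → repeats σ)) ≡⟨ ∑-cong (tuples n m) (λ σ → trans (∑-const (repeats σ) (allVecs n)) (*-comm N (repeats σ))) ⟩
      ∑ (tuples n m) (λ σ → repeats σ * N)                  ≡⟨ ∑-*ʳ N (tuples n m) repeats ⟩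
      R * N                                                ∎

-- Contractions of multigraphs

within : ∀ {v m} → Multigraph v m → (Fin v → Bool) → Fin m → Bool
within G B e = if B (proj₁ (ends G e)) then B (proj₂ (ends G e)) else false

-- inducedEdges is a local recursion that cannot be named here: the underscores stand for it and are
-- found by unification. The with-abstraction over suc k in induced-tail separates the number of edges
-- from the length of the remaining list, which the recursion has to treat as independent.
mutual
  inducedEdges-map : ∀ {v m} (G : Multigraph v m) B → inducedEdges G B ≡ Vec.map (within G B) (Vec.allFin m)
  inducedEdges-map {m = m} G B with Vec.allFin m
  ... | es = induced-all G B es

  induced-all : ∀ {v m} (G : Multigraph v m) B (es : Vec (Fin m) m) → _ ≡ Vec.map (within G B) es
  induced-all G B []       = refl
  induced-all G B (e ∷ es) = cong (_ ∷_) (induced-tail G B es)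

  induced-tail : ∀ {v k} (G : Multigraph v (suc k)) B (es : Vec (Fin (suc k)) k) → _ ≡ Vec.map (within G B) es
  induced-tail {k = k} G B es with suc k | G | es
  ... | m | G′ | es′ = induced-list G′ B es′

  induced-list : ∀ {v m} (G : Multigraph v m) B {k} (es : Vec (Fin m) k) → _ ≡ Vec.map (within G B) es
  induced-list G B []       = refl
  induced-list G B (e ∷ es) = cong (_ ∷_) (induced-list G B es)

lookup-inducedEdges : ∀ {v m} (G : Multigraph v m) B e → lookup (inducedEdges G B) e ≡ within G B e
lookup-inducedEdges {m = m} G B e = trans (cong (λ es → lookup es e) (inducedEdges-map G B))
  (trans (lookup-map e (within G B) (Vec.allFin m)) (cong (within G B) (lookup-allFin e)))

⌊⌋-true : ∀ {P : Set} (P? : Dec P) → ⌊ P? ⌋ ≡ true → P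
⌊⌋-true (yes p) _ = p

true-⌊⌋ : ∀ {P : Set} (P? : Dec P) → P → ⌊ P? ⌋ ≡ true
true-⌊⌋ (yes _) p = refl
true-⌊⌋ (no ¬p) p = ⊥-elim (¬p p)

false-⌊⌋ : ∀ {P : Set} (P? : Dec P) → ¬ P → ⌊ P? ⌋ ≡ false
false-⌊⌋ (yes p) ¬p = ⊥-elim (¬p p)
false-⌊⌋ (no _)  ¬p = refl

-- Finite choice that decides neither `A` nor `B`: a disjunction at each index is enough.
search : ∀ {n} {A B : Fin n → Set} → (∀ i → A i ⊎ B i) → (∀ i → A i) ⊎ ∃ B
search {zero}  f = inj₁ λ ()
search {suc n} f with f zero | search (λ i → f (suc i))
... | inj₂ b | _            = inj₂ (zero , b)
... | inj₁ _ | inj₂ (i , b) = inj₂ (suc i , b)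
... | inj₁ a | inj₁ as      = inj₁ λ { zero → a ; (suc i) → as i }

keep-member : ∀ {m} (T : Vec Bool m) {f g} b → g ≢ f → lookup T g ≡ true → lookup (T [ f ]≔ b) g ≡ true
keep-member T b g≢f Tg = trans (lookup∘update′ g≢f T b) Tg

kept-member : ∀ {m} (T : Vec Bool m) {f g} → lookup (T [ f ]≔ false) g ≡ true → g ≢ f × lookup T g ≡ true
kept-member T {f} {g} Tg with g ≟ f
... | yes refl = ⊥-elim (true≢false (trans (sym Tg) (lookup∘update f T false)))
... | no g≢f   = g≢f , trans (sym (lookup∘update′ g≢f T false)) Tg

kept-absent : ∀ {m} (T : Vec Bool m) {f g} → lookup (T [ f ]≔ false) g ≡ false → g ≢ f → lookup T g ≡ false
kept-absent T Tg g≢f = trans (sym (lookup∘update′ g≢f T false)) Tg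

countTrue-remove : ∀ {m} (L : Vec Bool m) e → lookup L e ≡ true → suc (countTrue (L [ e ]≔ false)) ≡ countTrue L
countTrue-remove (true ∷ L) zero    _    = refl
countTrue-remove (b ∷ L)    (suc e) live = trans (sym (+-suc (𝟙 b) _)) (cong (𝟙 b +_) (countTrue-remove L e live))

countFalse : ∀ {m} → Vec Bool m → ℕ
countFalse []      = 0
countFalse (b ∷ x) = 𝟙 (not b) + countFalse x

countFalse-add : ∀ {m} (x : Vec Bool m) e → lookup x e ≡ false → suc (countFalse (x [ e ]≔ true)) ≡ countFalse x
countFalse-add (false ∷ x) zero    _  = refl
countFalse-add (b ∷ x)     (suc e) xe = trans (sym (+-suc (𝟙 (not b)) _)) (cong (𝟙 (not b) +_) (countFalse-add x e xe))

-- Merging keeps all labels in `Fin v`: `a` merely falls out of use and becomes an isolated vertex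
-- of the quotient.
redirect : ∀ {v} → Fin v → Fin v → Fin v → Fin v
redirect a b c = if ⌊ c ≟ a ⌋ then b else c

redirect-at : ∀ {v} (a b : Fin v) {c} → c ≡ a → redirect a b c ≡ b
redirect-at a b {c} c≡a with c ≟ a
... | yes _  = refl
... | no c≢a = ⊥-elim (c≢a c≡a)

redirect-off : ∀ {v} (a b : Fin v) {c} → c ≢ a → redirect a b c ≡ c
redirect-off a b {c} c≢a with c ≟ a
... | yes c≡a = ⊥-elim (c≢a c≡a)
... | no _    = refl

redirect-avoids : ∀ {v} {a b : Fin v} → a ≢ b → ∀ c → redirect a b c ≢ a
redirect-avoids {a = a} a≢b c eq with c ≟ a
... | yes _  = a≢b (sym eq)
... | no c≢a = c≢a eq

redirect-inverse : ∀ {v} {a b : Fin v} {x} c → redirect a b c ≡ x → x ≢ b → c ≡ x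
redirect-inverse {a = a} c eq x≢b with c ≟ a
... | yes _ = ⊥-elim (x≢b (sym eq))
... | no _  = eq

redirect-collision : ∀ {v} {a b : Fin v} c d → redirect a b c ≡ redirect a b d → c ≢ d → (c ≡ a × d ≡ b) ⊎ (c ≡ b × d ≡ a)
redirect-collision {a = a} c d eq c≢d with c ≟ a | d ≟ a
... | yes c≡a | yes d≡a = ⊥-elim (c≢d (trans c≡a (sym d≡a)))
... | yes c≡a | no _    = inj₁ (c≡a , sym eq)
... | no _    | yes d≡a = inj₂ (eq , d≡a)
... | no _    | no _    = ⊥-elim (c≢d eq)

module _ {v m : ℕ} (G : Multigraph v m) where

  src tgt : Fin m → Fin v
  src e = proj₁ (ends G e)
  tgt e = proj₂ (ends G e)

  Reach-trans : ∀ {T x y z} → Reach G T x y → Reach G T y z → Reach G T x z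
  Reach-trans here          q = q
  Reach-trans (step e t j p) q = step e t j (Reach-trans p q)

  Joins-sym : ∀ {e x y} → Joins G e x y → Joins G e y x
  Joins-sym (inj₁ j) = inj₂ j
  Joins-sym (inj₂ j) = inj₁ j

  Reach-edge : ∀ {T e x y} → lookup T e ≡ true → Joins G e x y → Reach G T x y
  Reach-edge Te j = step _ Te j here

  Reach-sym : ∀ {T x y} → Reach G T x y → Reach G T y x
  Reach-sym here           = here
  Reach-sym (step e t j p) = Reach-trans (Reach-sym p) (Reach-edge t (Joins-sym j))

  -- An edge may become a walk, and a vertex may move. The exchange arguments for spanning sets take
  -- this form.
  Reach-map : ∀ {T U} (ρ : Fin v → Fin v) → (∀ e → lookup T e ≡ true → Reach G U (ρ (src e)) (ρ (tgt e))) →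
    ∀ {x y} → Reach G T x y → Reach G U (ρ x) (ρ y)
  Reach-map ρ f here = here
  Reach-map ρ f (step e t (inj₁ refl) p) = Reach-trans (f e t) (Reach-map ρ f p)
  Reach-map ρ f (step e t (inj₂ refl) p) = Reach-trans (Reach-sym (f e t)) (Reach-map ρ f p)

  _≼_ : Vec Bool m → Vec Bool m → Set
  T ≼ U = ∀ e → lookup T e ≡ true → lookup U e ≡ true

  Reach-mono : ∀ {T U} → T ≼ U → ∀ {x y} → Reach G T x y → Reach G U x y
  Reach-mono T≼U = Reach-map (λ x → x) (λ e t → Reach-edge (T≼U e t) (inj₁ refl))

  -- The vertices of the quotient are labels in `Fin v`, each standing for its fibre, which avoids
  -- quotient types. By `fibre` and `internal` the contracted edges stay inside the fibres and
  -- connect them, as branch sets require.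
  record Contraction : Set where
    field
      label    : Fin v → Fin v
      con      : Vec Bool m
      fibre    : ∀ {x y} → label x ≡ label y → Reach G con x y
      internal : ∀ e → lookup con e ≡ true → label (src e) ≡ label (tgt e)

    Links : Fin m → Fin v → Fin v → Set
    Links e a b = (label (src e) ≡ a × label (tgt e) ≡ b) ⊎ (label (src e) ≡ b × label (tgt e) ≡ a)

    -- Adjacency in the underlying simple graph: loops are excluded and parallel edges count once,
    -- so `Deg3` is about neighbours rather than edges.
    Adj : Fin v → Fin v → Set
    Adj a b = a ≢ b × ∃[ e ] Links e a b

    Deg3 : Fin v → Set
    Deg3 a = ∃[ p ] ∃[ q ] ∃[ r ] (Adj a p × Adj a q × Adj a r × p ≢ q × p ≢ r × q ≢ r)

    links? : ∀ e a b → Dec (Links e a b)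
    links? e a b = (label (src e) ≟ a ×-dec label (tgt e) ≟ b) ⊎-dec (label (src e) ≟ b ×-dec label (tgt e) ≟ a)

    adj? : ∀ a b → Dec (Adj a b)
    adj? a b = ¬? (a ≟ b) ×-dec any? (λ e → links? e a b)

    Links-sym : ∀ {e a b} → Links e a b → Links e b a
    Links-sym (inj₁ l) = inj₂ l
    Links-sym (inj₂ l) = inj₁ l

    Adj-sym : ∀ {a b} → Adj a b → Adj b a
    Adj-sym (a≢b , e , l) = a≢b ∘ sym , e , Links-sym l

    Links-joins : ∀ {e a b} → Links e a b → ∃[ x ] ∃[ y ] (Joins G e x y × label x ≡ a × label y ≡ b)
    Links-joins {e} (inj₁ (p , q)) = src e , tgt e , inj₁ refl , p , q
    Links-joins {e} (inj₂ (p , q)) = tgt e , src e , inj₂ refl , q , p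

    Links-Reach : ∀ {U e x y} → con ≼ U → lookup U e ≡ true → Links e (label x) (label y) → Reach G U x y
    Links-Reach con≼U Ue l = let p , q , j , px , qy = Links-joins l in
      Reach-trans (Reach-mono con≼U (fibre (sym px))) (step _ Ue j (Reach-mono con≼U (fibre qy)))

    external : ∀ {e a b} → a ≢ b → Links e a b → lookup con e ≡ false
    external {e} a≢b l with lookup con e in ce
    ... | false = refl
    external {e} a≢b (inj₁ (p , q)) | true = ⊥-elim (a≢b (trans (sym p) (trans (internal e ce) q)))
    external {e} a≢b (inj₂ (p , q)) | true = ⊥-elim (a≢b (trans (sym q) (trans (sym (internal e ce)) p)))

    rank : ℕ
    rank = countFalse con

    third : ∀ {x} → Deg3 x → ∀ a b → ∃[ t ] (Adj x t × t ≢ a × t ≢ b)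
    third (p , q , r , xp , xq , xr , p≢q , p≢r , q≢r) a b with p ≟ a | p ≟ b | q ≟ a | q ≟ b | r ≟ a | r ≟ b
    ... | no p≢a | no p≢b | _ | _ | _ | _ = p , xp , p≢a , p≢b
    ... | _ | _ | no q≢a | no q≢b | _ | _ = q , xq , q≢a , q≢b
    ... | _ | _ | _ | _ | no r≢a | no r≢b = r , xr , r≢a , r≢b
    ... | yes refl | _ | yes refl | _ | _ | _ = ⊥-elim (p≢q refl)
    ... | yes refl | _ | _ | _ | yes refl | _ = ⊥-elim (p≢r refl)
    ... | _ | _ | yes refl | _ | yes refl | _ = ⊥-elim (q≢r refl)
    ... | _ | yes refl | _ | yes refl | _ | _ = ⊥-elim (p≢q refl)
    ... | _ | yes refl | _ | _ | _ | yes refl = ⊥-elim (p≢r refl)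
    ... | _ | _ | _ | yes refl | _ | yes refl = ⊥-elim (q≢r refl)

    another? : ∀ x a b t →
      (∃[ u ] (Adj x u × u ≢ a × u ≢ b × u ≢ t)) ⊎ (∀ u → Adj x u → u ≡ a ⊎ u ≡ b ⊎ u ≡ t)
    another? x a b t with any? (λ u → adj? x u ×-dec ¬? (u ≟ a) ×-dec ¬? (u ≟ b) ×-dec ¬? (u ≟ t))
    ... | yes found = inj₁ found
    ... | no none   = inj₂ only
      where
      only : ∀ u → Adj x u → u ≡ a ⊎ u ≡ b ⊎ u ≡ t
      only u xu with u ≟ a | u ≟ b | u ≟ t
      ... | yes p | _     | _     = inj₁ p
      ... | no _  | yes p | _     = inj₂ (inj₁ p)
      ... | no _  | no _  | yes p = inj₂ (inj₂ p)
      ... | no p  | no q  | no r  = ⊥-elim (none (u , xu , p , q , r))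

  open Contraction

  module Contract (K : Contraction) {e a b} (a≢b : a ≢ b) (link : Links K e a b) where

    label′ : Fin v → Fin v
    label′ x = redirect a b (label K x)

    con≼ : con K ≼ (con K [ e ]≔ true)
    con≼ g cg with g ≟ e
    ... | yes refl = lookup∘update e (con K) true
    ... | no g≢e   = keep-member (con K) true g≢e cg

    bridge : ∀ {x y} → label K x ≡ a → label K y ≡ b → Reach G (con K [ e ]≔ true) x y
    bridge x≡a y≡b = Links-Reach K con≼ (lookup∘update e (con K) true) (subst₂ (Links K e) (sym x≡a) (sym y≡b) link)

    fibre′ : ∀ {x y} → label′ x ≡ label′ y → Reach G (con K [ e ]≔ true) x y
    fibre′ {x} {y} eq with label K x ≟ label K y
    ... | yes same = Reach-mono con≼ (fibre K same)
    ... | no differ with redirect-collision (label K x) (label K y) eq differ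
    ...   | inj₁ (x≡a , y≡b) = bridge x≡a y≡b
    ...   | inj₂ (x≡b , y≡a) = Reach-sym (bridge y≡a x≡b)

    joined : Links K e a b → label′ (src e) ≡ label′ (tgt e)
    joined (inj₁ (p , q)) = trans (redirect-at a b p) (sym (trans (cong (redirect a b) q) (redirect-off a b (a≢b ∘ sym))))
    joined (inj₂ (p , q)) = trans (trans (cong (redirect a b) p) (redirect-off a b (a≢b ∘ sym))) (sym (redirect-at a b q))

    internal′ : ∀ g → lookup (con K [ e ]≔ true) g ≡ true → label′ (src g) ≡ label′ (tgt g)
    internal′ g cg with g ≟ e
    ... | yes refl = joined link
    ... | no g≢e   = cong (redirect a b) (internal K g (trans (sym (lookup∘update′ g≢e (con K) true)) cg))

    contract : Contraction
    contract = record { label = label′ ; con = con K [ e ]≔ true ; fibre = fibre′ ; internal = internal′ }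

    rank-contract : rank contract < rank K
    rank-contract = ≤-reflexive (countFalse-add (con K) e (external K a≢b link))

    Links-contract : ∀ {g x y} → Links K g x y → Links contract g (redirect a b x) (redirect a b y)
    Links-contract (inj₁ (p , q)) = inj₁ (cong (redirect a b) p , cong (redirect a b) q)
    Links-contract (inj₂ (p , q)) = inj₂ (cong (redirect a b) p , cong (redirect a b) q)

    Adj-keep : ∀ {x y} → Adj K x y → x ≢ a → y ≢ a → Adj contract x y
    Adj-keep (x≢y , g , l) x≢a y≢a =
      x≢y , g , subst₂ (Links contract g) (redirect-off a b x≢a) (redirect-off a b y≢a) (Links-contract l)

    Adj-move : ∀ {y} → Adj K a y → y ≢ b → Adj contract b y
    Adj-move (a≢y , g , l) y≢b =
      y≢b ∘ sym , g , subst₂ (Links contract g) (redirect-at a b refl) (redirect-off a b (a≢y ∘ sym)) (Links-contract l)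

    Adj-dead : ∀ {x y} → Adj contract x y → x ≢ a
    Adj-dead (_ , g , inj₁ (p , _)) x≡a = redirect-avoids a≢b (label K (src g)) (trans p x≡a)
    Adj-dead (_ , g , inj₂ (_ , q)) x≡a = redirect-avoids a≢b (label K (tgt g)) (trans q x≡a)

    Adj-lift : ∀ {x y} → Adj contract x y → x ≢ b → ∃[ z ] (Adj K x z × redirect a b z ≡ y)
    Adj-lift {x} {y} (x≢y , g , l) x≢b = [ (λ (p , q) → lift _ _ (inj₁ (refl , refl)) p q) , (λ (p , q) → lift _ _ (inj₂ (refl , refl)) q p) ]′ l
      where
      lift : ∀ c d → Links K g c d → redirect a b c ≡ x → redirect a b d ≡ y → ∃[ z ] (Adj K x z × redirect a b z ≡ y)
      lift c d l p q = d , (subst (_≢ d) c≡x c≢d , g , subst (λ x → Links K g x d) c≡x l) , q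
        where
        c≡x = redirect-inverse c p x≢b
        c≢d : c ≢ d
        c≢d c≡d = x≢y (trans (sym p) (trans (cong (redirect a b) c≡d) q))

    -- Two neighbours of `x` are identified only if they are `a` and `b`, so the degree can drop
    -- only at common neighbours of these.
    Deg3-contract : ∀ {x} → Deg3 K x → x ≢ a → x ≢ b → ¬ (Adj K x a × Adj K x b) → Deg3 contract x
    Deg3-contract {x} (p , q , r , xp , xq , xr , p≢q , p≢r , q≢r) x≢a x≢b apart =
      redirect a b p , redirect a b q , redirect a b r , adj xp , adj xq , adj xr ,
      distinct xp xq p≢q , distinct xp xr p≢r , distinct xq xr q≢r
      where
      adj : ∀ {y} → Adj K x y → Adj contract x (redirect a b y)
      adj {y} xy with y ≟ a
      ... | yes refl = Adj-sym contract (Adj-move (Adj-sym K xy) x≢b)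
      ... | no y≢a   = Adj-keep xy x≢a y≢a
      distinct : ∀ {y z} → Adj K x y → Adj K x z → y ≢ z → redirect a b y ≢ redirect a b z
      distinct {y} {z} xy xz y≢z eq with redirect-collision y z eq y≢z
      ... | inj₁ (refl , refl) = apart (xy , xz)
      ... | inj₂ (refl , refl) = apart (xz , xy)

  -- The fibres of four pairwise adjacent labels are branch sets, since the contracted edges connect
  -- each fibre from inside.
  k4-model : (K : Contraction) (f : Fin 4 → Fin v) → (∀ i j → i ≢ j → Adj K (f i) (f j)) → K4Model G
  k4-model K f adj = record
    { branch   = branch
    ; nonempty = nonempty
    ; disjoint = λ i j x i≢j xi → false-⌊⌋ (label K x ≟ f j) (λ xj → proj₁ (adj i j i≢j) (trans (sym (in-fibre i x xi)) xj))
    ; conn     = λ i x y xi yi → inside i (in-fibre i x xi) (fibre K (trans (in-fibre i x xi) (sym (in-fibre i y yi))))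
    ; adjacent = λ i j i≢j → let _ , e , l = adj i j i≢j
                                 x , y , j , p , q = Links-joins K l
                             in e , x , y , j , true-⌊⌋ (label K x ≟ _) p , true-⌊⌋ (label K y ≟ _) q
    }
    where
    branch : Fin 4 → Fin v → Bool
    branch i x = ⌊ label K x ≟ f i ⌋

    in-fibre : ∀ i x → branch i x ≡ true → label K x ≡ f i
    in-fibre i x = ⌊⌋-true (label K x ≟ f i)

    vertex : ∀ {i j} → Adj K (f i) (f j) → ∃[ x ] branch i x ≡ true
    vertex (_ , e , l) = let x , _ , _ , p , _ = Links-joins K l in x , true-⌊⌋ (label K x ≟ _) p

    nonempty : ∀ i → ∃[ x ] branch i x ≡ true
    nonempty zero    = vertex (adj zero (suc zero) λ ())
    nonempty (suc i) = vertex (adj (suc i) zero λ ())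

    inside : ∀ i {x y} → label K x ≡ f i → Reach G (con K) x y → Reach G (inducedEdges G (branch i)) x y
    inside i xi here = here
    inside i xi (step e ce j p) = step e induced j (inside i (yi j) p)
      where
      both : ∀ {x y} → label K x ≡ f i → Joins G e x y → label K (src e) ≡ f i × label K (tgt e) ≡ f i
      both xi (inj₁ refl) = xi , trans (sym (internal K e ce)) xi
      both xi (inj₂ refl) = trans (internal K e ce) xi , xi
      yi : ∀ {y} → Joins G e _ y → label K y ≡ f i
      yi (inj₁ refl) = proj₂ (both xi j)
      yi (inj₂ refl) = proj₁ (both xi j)
      induced : lookup (inducedEdges G (branch i)) e ≡ true
      induced = trans (lookup-inducedEdges G (branch i) e) (trans
        (cong (λ c → if c then branch i (tgt e) else false) (true-⌊⌋ (label K (src e) ≟ f i) (proj₁ (both xi j))))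
        (true-⌊⌋ (label K (tgt e) ≟ f i) (proj₂ (both xi j))))

  k4-labels : (K : Contraction) → ∀ {a b c d} → Adj K a b → Adj K a c → Adj K a d → Adj K b c → Adj K b d → Adj K c d →
    K4Model G
  k4-labels K {a} {b} {c} {d} ab ac ad bc bd cd = k4-model K (lookup (a ∷ b ∷ c ∷ d ∷ [])) adj
    where
    adj : ∀ i j → i ≢ j → Adj K (lookup (a ∷ b ∷ c ∷ d ∷ []) i) (lookup (a ∷ b ∷ c ∷ d ∷ []) j)
    adj zero                   zero                   i≢j = ⊥-elim (i≢j refl)
    adj zero                   (suc zero)             _   = ab
    adj zero                   (suc (suc zero))       _   = ac
    adj zero                   (suc (suc (suc zero))) _   = ad
    adj (suc zero)             zero                   _   = Adj-sym K ab
    adj (suc zero)             (suc zero)             i≢j = ⊥-elim (i≢j refl)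
    adj (suc zero)             (suc (suc zero))       _   = bc
    adj (suc zero)             (suc (suc (suc zero))) _   = bd
    adj (suc (suc zero))       zero                   _   = Adj-sym K ac
    adj (suc (suc zero))       (suc zero)             _   = Adj-sym K bc
    adj (suc (suc zero))       (suc (suc zero))       i≢j = ⊥-elim (i≢j refl)
    adj (suc (suc zero))       (suc (suc (suc zero))) _   = cd
    adj (suc (suc (suc zero))) zero                   _   = Adj-sym K ad
    adj (suc (suc (suc zero))) (suc zero)             _   = Adj-sym K bd
    adj (suc (suc (suc zero))) (suc (suc zero))       _   = Adj-sym K cd
    adj (suc (suc (suc zero))) (suc (suc (suc zero))) i≢j = ⊥-elim (i≢j refl)

  -- K₄ minors from minimum degree 3

  Rooted : Contraction → Fin v → Set
  Rooted K w = ∃ (Adj K w) × (∀ x → x ≢ w → ∃ (Adj K x) → Deg3 K x)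

  -- Contracting z into the root w keeps all other degrees ≥ 3 unless z and w have a common neighbour
  -- of degree 3. Starting from such a neighbour y, the same obstruction gives a second one y′, adjacent
  -- to y; the cases below are distinguished by the remaining neighbours t of y and t′ of y′.
  module RootedStep (K : Contraction) (w : Fin v) (deg : ∀ x → x ≢ w → ∃ (Adj K x) → Deg3 K x)
    (recurse : ∀ K′ → rank K′ < rank K → Rooted K′ w → K4Model G) where

    -- Merging `z` into `w` costs a common neighbour `y` one neighbour; `w`, `t` and `u` then still
    -- make three.
    Spare : Fin v → Fin v → Set
    Spare z y = Adj K w y → Adj K z y →
      ∃[ t ] ∃[ u ] (Adj K y t × Adj K y u × t ≢ w × t ≢ z × u ≢ w × u ≢ z × t ≢ u)

    Tight : Fin v → Fin v → Set
    Tight z y = Adj K w y × Adj K z y × ∃[ t ] (Adj K y t × t ≢ w × t ≢ z ×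
      (∀ u → Adj K y u → u ≡ w ⊎ u ≡ z ⊎ u ≡ t))

    spare-or-tight : ∀ z y → Spare z y ⊎ Tight z y
    spare-or-tight z y with adj? K w y | adj? K z y
    ... | no ¬wy | _      = inj₁ λ wy → ⊥-elim (¬wy wy)
    ... | yes _  | no ¬zy = inj₁ λ _ zy → ⊥-elim (¬zy zy)
    ... | yes wy | yes zy with third K (deg y (proj₁ wy ∘ sym) (z , Adj-sym K zy)) w z
    ...   | t , yt , t≢w , t≢z with another? K y w z t
    ...     | inj₁ (u , yu , u≢w , u≢z , u≢t) = inj₁ λ _ _ → t , u , yt , yu , t≢w , t≢z , u≢w , u≢z , u≢t ∘ sym
    ...     | inj₂ only = inj₂ (wy , zy , t , yt , t≢w , t≢z , only)

    absorb : ∀ z → Adj K w z → (∀ y → Spare z y) → K4Model G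
    absorb z wz@(w≢z , e , l) spare = recurse C.contract C.rank-contract (root , deg′)
      where
      module C = Contract K (w≢z ∘ sym) (Links-sym K l)
      root : ∃ (Adj C.contract w)
      root = let t , zt , t≢w , _ = third K (deg z (w≢z ∘ sym) (w , Adj-sym K wz)) w w in t , C.Adj-move zt t≢w
      deg′ : ∀ x → x ≢ w → ∃ (Adj C.contract x) → Deg3 C.contract x
      deg′ x x≢w (y , xy) with C.Adj-lift xy x≢w | C.Adj-dead xy | adj? K x z | adj? K x w
      ... | y′ , xy′ , _ | x≢z | no ¬xz | _      = C.Deg3-contract (deg x x≢w (y′ , xy′)) x≢z x≢w (¬xz ∘ proj₁)
      ... | y′ , xy′ , _ | x≢z | yes _  | no ¬xw = C.Deg3-contract (deg x x≢w (y′ , xy′)) x≢z x≢w (¬xw ∘ proj₂)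
      ... | _            | x≢z | yes xz | yes xw =
        let t , u , xt , xu , t≢w , t≢z , u≢w , u≢z , t≢u = spare x (Adj-sym K xw) (Adj-sym K xz) in
        w , t , u , C.Adj-keep xw x≢z w≢z , C.Adj-keep xt x≢z t≢z , C.Adj-keep xu x≢z u≢z ,
        t≢w ∘ sym , u≢w ∘ sym , t≢u

    -- A triangle `w`, `y`, `y′` in which `y` and `y′` each have just one further neighbour, the
    -- tips `t` and `t′`.
    module Diamond {y y′ t t′ : Fin v} (wy : Adj K w y) (wy′ : Adj K w y′) (yy′ : Adj K y y′)
      (yt : Adj K y t) (t≢w : t ≢ w) (t≢y′ : t ≢ y′) (only : ∀ u → Adj K y u → u ≡ w ⊎ u ≡ y′ ⊎ u ≡ t)
      (y′t′ : Adj K y′ t′) (t′≢w : t′ ≢ w) (t′≢y : t′ ≢ y) (only′ : ∀ u → Adj K y′ u → u ≡ w ⊎ u ≡ y ⊎ u ≡ t′) where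

      w≢y = proj₁ wy
      w≢y′ = proj₁ wy′
      y≢y′ = proj₁ yy′
      y≢t = proj₁ yt

      -- Merging `y′` into `y` leaves `y` with `w`, `t` and `t′`. A common neighbour of `y` and `y′`
      -- other than `w` would be both tips at once.
      distinct-tips : t ≢ t′ → K4Model G
      distinct-tips t≢t′ = recurse C.contract C.rank-contract ((y , C.Adj-keep wy w≢y′ y≢y′) , deg′)
        where
        module C = Contract K (y≢y′ ∘ sym) (Links-sym K (proj₂ (proj₂ yy′)))
        deg′ : ∀ x → x ≢ w → ∃ (Adj C.contract x) → Deg3 C.contract x
        deg′ x x≢w (u , xu) with x ≟ y
        ... | yes refl = w , t , t′ , C.Adj-keep (Adj-sym K wy) y≢y′ w≢y′ , C.Adj-keep yt y≢y′ t≢y′ ,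
          C.Adj-move y′t′ t′≢y , t≢w ∘ sym , t′≢w ∘ sym , t≢t′
        ... | no x≢y = let z , xz , _ = C.Adj-lift xu x≢y in
          C.Deg3-contract (deg x x≢w (z , xz)) (C.Adj-dead xu) x≢y apart
          where
          apart : ¬ (Adj K x y′ × Adj K x y)
          apart (xy′ , xy) with only x (Adj-sym K xy) | only′ x (Adj-sym K xy′)
          ... | inj₁ x≡w         | _                = x≢w x≡w
          ... | inj₂ (inj₁ x≡y′) | _                = C.Adj-dead xu x≡y′
          ... | inj₂ (inj₂ _)    | inj₁ x≡w         = x≢w x≡w
          ... | inj₂ (inj₂ _)    | inj₂ (inj₁ x≡y)  = x≢y x≡y
          ... | inj₂ (inj₂ x≡t)  | inj₂ (inj₂ x≡t′) = t≢t′ (trans (sym x≡t) x≡t′)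

      module SameTip (t≡t′ : t ≡ t′) where

        y′t : Adj K y′ t
        y′t = subst (Adj K y′) (sym t≡t′) y′t′

        y′≢t = proj₁ y′t

        tip-adjacent : Adj K w t → K4Model G
        tip-adjacent wt = k4-labels K wy wy′ wt yy′ yt y′t

        module _ (¬wt : ¬ Adj K w t) {s} (ts : Adj K t s) (s≢y : s ≢ y) (s≢y′ : s ≢ y′) where

          s≢w : s ≢ w
          s≢w refl = ¬wt (Adj-sym K ts)

          -- Both `y` and `y′` are merged into `w`. Apart from these three, only `t` is adjacent to
          -- `y` or `y′`, and it keeps `w`, `s` and `u`.
          large-tip : ∀ {u} → Adj K t u → u ≢ y → u ≢ y′ → u ≢ s → K4Model G
          large-tip {u} tu u≢y u≢y′ u≢s =
            recurse C₂.contract (<-trans C₂.rank-contract C₁.rank-contract) ((t , Adj-sym C₂.contract tw) , deg′)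
            where
            module C₁ = Contract K (w≢y ∘ sym) (Links-sym K (proj₂ (proj₂ wy)))
            y′w : Adj C₁.contract y′ w
            y′w = C₁.Adj-keep (Adj-sym K wy′) (y≢y′ ∘ sym) w≢y
            module C₂ = Contract C₁.contract (proj₁ y′w) (proj₂ (proj₂ y′w))
            u≢w : u ≢ w
            u≢w refl = ¬wt (Adj-sym K tu)
            tw : Adj C₂.contract t w
            tw = Adj-sym C₂.contract (C₂.Adj-keep (C₁.Adj-move yt t≢w) w≢y′ t≢y′)
            keep : ∀ {x} → Adj K t x → x ≢ y → x ≢ y′ → Adj C₂.contract t x
            keep tx x≢y x≢y′ = C₂.Adj-keep (C₁.Adj-keep tx (y≢t ∘ sym) x≢y) t≢y′ x≢y′
            deg′ : ∀ x → x ≢ w → ∃ (Adj C₂.contract x) → Deg3 C₂.contract x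
            deg′ x x≢w (c , xc) with x ≟ t
            ... | yes refl = w , s , u , tw , keep ts s≢y s≢y′ , keep tu u≢y u≢y′ , s≢w ∘ sym , u≢w ∘ sym , u≢s ∘ sym
            ... | no x≢t with C₂.Adj-lift xc x≢w
            ...   | d , xd , _ with C₁.Adj-lift xd x≢w
            ...     | z , xz , _ =
              C₂.Deg3-contract (C₁.Deg3-contract (deg x x≢w (z , xz)) x≢y x≢w (¬xy ∘ proj₁)) x≢y′ x≢w (¬xy′ ∘ proj₁)
              where
              x≢y′ = C₂.Adj-dead xc
              x≢y = C₁.Adj-dead xd
              ¬xy : ¬ Adj K x y
              ¬xy xy with only x (Adj-sym K xy)
              ... | inj₁ x≡w         = x≢w x≡w
              ... | inj₂ (inj₁ x≡y′) = x≢y′ x≡y′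
              ... | inj₂ (inj₂ x≡t)  = x≢t x≡t
              ¬xy′ : ¬ Adj C₁.contract x y′
              ¬xy′ xy′ with C₁.Adj-lift xy′ x≢w
              ... | z′ , xz′ , eq with redirect-inverse z′ eq (w≢y′ ∘ sym)
              ...   | refl with only′ x (Adj-sym K xz′)
              ...     | inj₁ x≡w         = x≢w x≡w
              ...     | inj₂ (inj₁ x≡y)  = x≢y x≡y
              ...     | inj₂ (inj₂ x≡t′) = x≢t (trans x≡t′ (sym t≡t′))

          -- Here `t` is merged into `s`, which inherits `y` and `y′` and keeps a third neighbour.
          -- Every neighbour of `t` besides `s` is `y` or `y′`, and these are not adjacent to `s`,
          -- so no other degree drops.
          small-tip : (∀ u → Adj K t u → u ≡ y ⊎ u ≡ y′ ⊎ u ≡ s) → K4Model G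
          small-tip only-t = recurse C.contract C.rank-contract ((y , C.Adj-keep wy (t≢w ∘ sym) y≢t) , deg′)
            where
            module C = Contract K (proj₁ ts) (proj₂ (proj₂ ts))
            s≢t = proj₁ ts ∘ sym
            ¬ys : ¬ Adj K y s
            ¬ys ys with only s ys
            ... | inj₁ s≡w         = s≢w s≡w
            ... | inj₂ (inj₁ s≡y′) = s≢y′ s≡y′
            ... | inj₂ (inj₂ s≡t)  = s≢t s≡t
            ¬y′s : ¬ Adj K y′ s
            ¬y′s y′s with only′ s y′s
            ... | inj₁ s≡w         = s≢w s≡w
            ... | inj₂ (inj₁ s≡y)  = s≢y s≡y
            ... | inj₂ (inj₂ s≡t′) = s≢t (trans s≡t′ (sym t≡t′))
            deg′ : ∀ x → x ≢ w → ∃ (Adj C.contract x) → Deg3 C.contract x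
            deg′ x x≢w (c , xc) with x ≟ s
            ... | yes refl = let u , su , u≢t , _ = third K (deg s s≢w (t , Adj-sym K ts)) t t in
              y , y′ , u , C.Adj-move (Adj-sym K yt) (s≢y ∘ sym) , C.Adj-move (Adj-sym K y′t) (s≢y′ ∘ sym) ,
              C.Adj-keep su s≢t u≢t , y≢y′ ,
              (λ y≡u → ¬ys (Adj-sym K (subst (Adj K s) (sym y≡u) su))) ,
              (λ y′≡u → ¬y′s (Adj-sym K (subst (Adj K s) (sym y′≡u) su)))
            ... | no x≢s = let z , xz , _ = C.Adj-lift xc x≢s in
              C.Deg3-contract (deg x x≢w (z , xz)) (C.Adj-dead xc) x≢s apart
              where
              apart : ¬ (Adj K x t × Adj K x s)
              apart (xt , xs) with only-t x (Adj-sym K xt)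
              ... | inj₁ refl        = ¬ys xs
              ... | inj₂ (inj₁ refl) = ¬y′s xs
              ... | inj₂ (inj₂ x≡s)  = x≢s x≡s

      k4 : K4Model G
      k4 with t ≟ t′
      ... | no t≢t′ = distinct-tips t≢t′
      ... | yes t≡t′ with adj? K w t | third K (deg t t≢w (y , Adj-sym K yt)) y y′
      ...   | yes wt | _ = SameTip.tip-adjacent t≡t′ wt
      ...   | no ¬wt | s , ts , s≢y , s≢y′ with another? K t y y′ s
      ...     | inj₁ (u , tu , u≢y , u≢y′ , u≢s) = SameTip.large-tip t≡t′ ¬wt ts s≢y s≢y′ tu u≢y u≢y′ u≢s
      ...     | inj₂ only-t = SameTip.small-tip t≡t′ ¬wt ts s≢y s≢y′ only-t

    k4 : ∀ z → Adj K w z → K4Model G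
    k4 z wz with search (spare-or-tight z)
    ... | inj₁ spare = absorb z wz spare
    ... | inj₂ (y , wy , zy , t , yt , t≢w , t≢z , only) with search (spare-or-tight y)
    ...   | inj₁ spare = absorb y wy spare
    ...   | inj₂ (y′ , wy′ , yy′ , t′ , y′t′ , t′≢w , t′≢y , only′) with only y′ yy′
    -- The neighbours of `y` are `w`, `z` and `t`, so `y′` is `z` or `t`; the other of the two
    -- becomes the tip of `y`.
    ...     | inj₁ y′≡w = ⊥-elim (proj₁ wy′ (sym y′≡w))
    ...     | inj₂ (inj₁ refl) = Diamond.k4 wy wy′ yy′ yt t≢w t≢z only y′t′ t′≢w t′≢y only′
    ...     | inj₂ (inj₂ refl) = Diamond.k4 wy wy′ yy′ (Adj-sym K zy) (proj₁ wz ∘ sym) (t≢z ∘ sym)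
      (λ u yu → [ inj₁ , [ inj₂ ∘ inj₂ , inj₂ ∘ inj₁ ]′ ]′ (only u yu)) y′t′ t′≢w t′≢y only′

  rooted-k4 : ∀ fuel K w → rank K < fuel → Rooted K w → K4Model G
  rooted-k4 (suc fuel) K w (s≤s rank≤) ((z , wz) , deg) =
    RootedStep.k4 K w deg (λ K′ less → rooted-k4 fuel K′ w (≤-trans less rank≤)) z wz

  -- Series–parallel reduction of the spanning sets

  Conn : Vec Bool m → Set
  Conn = ConnectedVia G

  Conn-mono : ∀ {T U} → T ≼ U → Conn T → Conn U
  Conn-mono T≼U conn x y = Reach-mono T≼U (conn x y)

  Incident : Contraction → Fin m → Fin v → Set
  Incident K e x = label K (src e) ≡ x ⊎ label K (tgt e) ≡ x

  incident? : ∀ K e x → Dec (Incident K e x)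
  incident? K e x = (label K (src e) ≟ x) ⊎-dec (label K (tgt e) ≟ x)

  cross-link : ∀ K {e x} → label K (src e) ≢ label K (tgt e) → Incident K e x → ∃[ b ] (x ≢ b × Links K e x b)
  cross-link K cross (inj₁ refl) = _ , cross , inj₁ (refl , refl)
  cross-link K cross (inj₂ refl) = _ , cross ∘ sym , inj₂ (refl , refl)

  exit-edge : ∀ K {T x y z} → Reach G T y z → label K y ≡ x → label K z ≢ x →
    ∃[ g ] (lookup T g ≡ true × Incident K g x × label K (src g) ≢ label K (tgt g))
  exit-edge K here yx zx = ⊥-elim (zx yx)
  exit-edge K {x = x} (step {y = u} e Te j p) yx zx with label K u ≟ x
  ... | yes ux = exit-edge K p ux zx
  ... | no ¬ux = e , Te , leaving j
    where
    leaving : Joins G e _ u → Incident K e x × label K (src e) ≢ label K (tgt e)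
    leaving (inj₁ refl) = inj₁ yx , λ eq → ¬ux (trans (sym eq) yx)
    leaving (inj₂ refl) = inj₂ yx , λ eq → ¬ux (trans eq yx)

  -- If e and f are the only edges leaving a fibre x, a spanning connected set through e alone stays
  -- connected when e is replaced by f: collapse the fibre to the outer end of e.
  reroute : ∀ K {T U x e f a b} → x ≢ a → x ≢ b → Links K e x a → Links K f x b →
    (∀ g → lookup T g ≡ true → Incident K g x → label K (src g) ≢ label K (tgt g) → g ≡ e) →
    (∀ g → lookup T g ≡ true → g ≢ e → lookup U g ≡ true) → lookup U f ≡ true → con K ≼ U → Conn T → Conn U
  reroute K {T} {U} {x} {e} {f} x≢a x≢b link-e link-f only keep Uf con≼U conn y z =
    let y′ , y′-out , yy′ = outer y ; z′ , z′-out , zz′ = outer z in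
    Reach-trans yy′ (Reach-trans
      (subst₂ (Reach G U) (ρ-out y′-out) (ρ-out z′-out) (Reach-map ρ ρ-edge (conn y′ z′))) (Reach-sym zz′))
    where
    end-e = Links-joins K link-e
    end-f = Links-joins K link-f
    p = proj₁ end-e
    q = proj₁ (proj₂ end-e)
    joins-e = proj₁ (proj₂ (proj₂ end-e))
    p-in : label K p ≡ x
    p-in = proj₁ (proj₂ (proj₂ (proj₂ end-e)))
    q-out : label K q ≢ x
    q-out q-in = x≢a (trans (sym q-in) (proj₂ (proj₂ (proj₂ (proj₂ end-e)))))

    ρ : Fin v → Fin v
    ρ y = if ⌊ label K y ≟ x ⌋ then q else y

    ρ-in : ∀ {y} → label K y ≡ x → ρ y ≡ q
    ρ-in {y} y-in = cong (λ c → if c then q else y) (true-⌊⌋ (label K y ≟ x) y-in)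

    ρ-out : ∀ {y} → label K y ≢ x → ρ y ≡ y
    ρ-out {y} y-out = cong (λ c → if c then q else y) (false-⌊⌋ (label K y ≟ x) y-out)

    ρ-ends : ∀ {y z} → Joins G e y z → ρ y ≡ ρ z → ρ (src e) ≡ ρ (tgt e)
    ρ-ends (inj₁ refl) eq = eq
    ρ-ends (inj₂ refl) eq = sym eq

    ρ-e : ρ (src e) ≡ ρ (tgt e)
    ρ-e = ρ-ends joins-e (trans (ρ-in p-in) (sym (ρ-out q-out)))

    ρ-edge-cases : ∀ g → lookup T g ≡ true → Dec (g ≡ e) → Dec (label K (src g) ≡ x) → Dec (label K (tgt g) ≡ x) →
      Reach G U (ρ (src g)) (ρ (tgt g))
    ρ-edge-cases g Tg (yes refl) _         _         = subst (Reach G U (ρ (src e))) ρ-e here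
    ρ-edge-cases g Tg (no _)     (yes s∈x) (yes t∈x) = subst (Reach G U (ρ (src g))) (trans (ρ-in s∈x) (sym (ρ-in t∈x))) here
    ρ-edge-cases g Tg (no g≢e)   (yes s∈x) (no t∉x)  = ⊥-elim (g≢e (only g Tg (inj₁ s∈x) (λ eq → t∉x (trans (sym eq) s∈x))))
    ρ-edge-cases g Tg (no g≢e)   (no s∉x)  (yes t∈x) = ⊥-elim (g≢e (only g Tg (inj₂ t∈x) (λ eq → s∉x (trans eq t∈x))))
    ρ-edge-cases g Tg (no g≢e)   (no s∉x)  (no t∉x)  =
      subst₂ (Reach G U) (sym (ρ-out s∉x)) (sym (ρ-out t∉x)) (Reach-edge (keep g Tg g≢e) (inj₁ refl))

    ρ-edge : ∀ g → lookup T g ≡ true → Reach G U (ρ (src g)) (ρ (tgt g))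
    ρ-edge g Tg = ρ-edge-cases g Tg (g ≟ e) (label K (src g) ≟ x) (label K (tgt g) ≟ x)

    outer : ∀ y → ∃[ z ] (label K z ≢ x × Reach G U y z)
    outer y with label K y ≟ x
    ... | no y-out = y , y-out , here
    ... | yes y-in = let r , s , joins-f , r-in , s≡b = end-f in
      s , (λ s-in → x≢b (trans (sym s-in) s≡b)) ,
      Reach-trans (Reach-mono con≼U (fibre K (trans y-in (sym r-in)))) (Reach-edge Uf joins-f)

  -- The sets of live edges that, together with the contracted edges, minimally span the minor of G
  -- given by a contraction and a set L of live edges, the remaining edges being deleted.
  record Spans (K : Contraction) (L : Vec Bool m) (T : Vec Bool m) : Set where
    field
      conn    : Conn T
      minimal : ∀ g → lookup L g ≡ true → lookup T g ≡ true → ¬ Conn (T [ g ]≔ false)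
      agree   : ∀ g → lookup L g ≡ false → lookup T g ≡ lookup (con K) g

  -- Adjacency in a contraction is defined by all edges of `G`, live or not. `realised` says that
  -- deletion has lost none of it, so degrees may be counted with live edges while the search for K₄
  -- looks at `K` alone.
  record Minor (K : Contraction) (L : Vec Bool m) : Set where
    field
      live-con : ∀ e → lookup L e ≡ true → lookup (con K) e ≡ false
      realised : ∀ e → label K (src e) ≢ label K (tgt e) →
        ∃[ g ] (lookup L g ≡ true × Links K g (label K (src e)) (label K (tgt e)))

  module Reduce (K : Contraction) (L : Vec Bool m) (minor : Minor K L) where

    open Minor minor
    open Spans

    con-dead : ∀ {g} → lookup (con K) g ≡ true → lookup L g ≡ false
    con-dead {g} cg with lookup L g in Lg
    ... | false = refl
    ... | true  = ⊥-elim (true≢false (trans (sym cg) (live-con g Lg)))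

    live≢dead : ∀ {g h} → lookup L g ≡ true → lookup L h ≡ false → h ≢ g
    live≢dead Lg Lh refl = true≢false (trans (sym Lg) Lh)

    con≼span : ∀ {T} → Spans K L T → con K ≼ T
    con≼span span g cg = trans (agree span g (con-dead cg)) cg

    con≼remove : ∀ {T e} → Spans K L T → lookup L e ≡ true → con K ≼ (T [ e ]≔ false)
    con≼remove {T} span live g cg = keep-member T false (live≢dead live (con-dead cg)) (con≼span span g cg)

    live-cross : ∀ {T} → Spans K L T → ∀ g → lookup T g ≡ true → label K (src g) ≢ label K (tgt g) → lookup L g ≡ true
    live-cross span g Tg cross with lookup L g in Lg
    ... | true  = refl
    ... | false = ⊥-elim (cross (internal K g (trans (sym (agree span g Lg)) Tg)))

    spans-delete : ∀ {T} e → lookup L e ≡ true → lookup T e ≡ false → Spans K L T → Spans K (L [ e ]≔ false) T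
    spans-delete {T} e live Te span = record
      { conn    = conn span
      ; minimal = λ g Lg → minimal span g (proj₂ (kept-member L Lg))
      ; agree   = agree′
      }
      where
      agree′ : ∀ g → lookup (L [ e ]≔ false) g ≡ false → lookup T g ≡ lookup (con K) g
      agree′ g Lg with g ≟ e
      ... | yes refl = trans Te (sym (live-con e live))
      ... | no g≢e   = agree span g (kept-absent L Lg g≢e)

    -- The contracted edges already join the ends of `e`, so by minimality no spanning set contains
    -- it.
    good-loop : ∀ e → lookup L e ≡ true → label K (src e) ≡ label K (tgt e) →
      (Minor K (L [ e ]≔ false) → Good (L [ e ]≔ false) (Spans K (L [ e ]≔ false))) → Good L (Spans K L)
    good-loop e live loop rec = good-fixed L _ _ e false live
      (λ T span → absent T span , spans-delete e live (absent T span) span)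
      (rec (record { live-con = λ g Lg → live-con g (proj₂ (kept-member L Lg)) ; realised = realised′ }))
      where
      absent : ∀ T → Spans K L T → lookup T e ≡ false
      absent T span with lookup T e in Te
      ... | false = refl
      ... | true  = ⊥-elim (minimal span e live Te (λ x y → Reach-map (λ x → x) bypass (conn span x y)))
        where
        bypass : ∀ g → lookup T g ≡ true → Reach G (T [ e ]≔ false) (src g) (tgt g)
        bypass g Tg with g ≟ e
        ... | yes refl = Reach-mono (con≼remove span live) (fibre K loop)
        ... | no g≢e   = Reach-edge (keep-member T false g≢e Tg) (inj₁ refl)
      realised′ : ∀ g → label K (src g) ≢ label K (tgt g) →
        ∃[ h ] (lookup (L [ e ]≔ false) h ≡ true × Links K h (label K (src g)) (label K (tgt g)))
      realised′ g cross with realised g cross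
      ... | h , Lh , l with h ≟ e
      ...   | no h≢e   = h , keep-member L false h≢e Lh , l
      ...   | yes refl with l
      ...     | inj₁ (p , q) = ⊥-elim (cross (trans (sym p) (trans loop q)))
      ...     | inj₂ (p , q) = ⊥-elim (cross (trans (sym q) (trans (sym loop) p)))

    -- By minimality a spanning set contains at most one of `e` and `f`, and exchanging `f` for `e`
    -- gives a spanning set again: the doubling with `c` false.
    good-parallel : ∀ e f → e ≢ f → lookup L e ≡ true → lookup L f ≡ true → Links K f (label K (src e)) (label K (tgt e)) →
      (Minor K (L [ f ]≔ false) → Good (L [ f ]≔ false) (Spans K (L [ f ]≔ false))) → Good L (Spans K L)
    good-parallel e f e≢f e-live f-live par rec = good-duplicate L _ _ e f false e≢f e-live f-live cases
      (rec (record { live-con = λ g Lg → live-con g (proj₂ (kept-member L Lg)) ; realised = realised′ }))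
      where
      par′ : Links K e (label K (src f)) (label K (tgt f))
      par′ = [ (λ (p , q) → inj₁ (sym p , sym q)) , (λ (p , q) → inj₂ (sym q , sym p)) ]′ par

      parallel-trans : ∀ {a b} → Links K f a b → Links K e a b
      parallel-trans (inj₁ (refl , refl)) = par′
      parallel-trans (inj₂ (refl , refl)) = Links-sym K par′

      realised′ : ∀ g → label K (src g) ≢ label K (tgt g) →
        ∃[ h ] (lookup (L [ f ]≔ false) h ≡ true × Links K h (label K (src g)) (label K (tgt g)))
      realised′ g cross with realised g cross
      ... | h , Lh , l with h ≟ f
      ...   | no h≢f   = h , keep-member L false h≢f Lh , l
      ...   | yes refl = e , keep-member L false e≢f e-live , parallel-trans l

      cases : ∀ T → Spans K L T → (lookup T f ≡ false × Spans K (L [ f ]≔ false) T) ⊎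
        (lookup T f ≡ true × lookup T e ≡ false × Spans K (L [ f ]≔ false) ((T [ e ]≔ true) [ f ]≔ false))
      cases T span with lookup T f in Tf
      ... | false = inj₁ (refl , spans-delete f f-live Tf span)
      ... | true  = inj₂ (refl , e-absent , record { conn = conn′ ; minimal = minimal′ ; agree = agree′ })
        where
        T′ = (T [ e ]≔ true) [ f ]≔ false

        e-absent : lookup T e ≡ false
        e-absent with lookup T e in Te
        ... | false = refl
        ... | true  = ⊥-elim (minimal span f f-live Tf (λ x y → Reach-map (λ x → x) bypass (conn span x y)))
          where
          bypass : ∀ g → lookup T g ≡ true → Reach G (T [ f ]≔ false) (src g) (tgt g)
          bypass g Tg with g ≟ f
          ... | yes refl = Links-Reach K (con≼remove span f-live) (keep-member T false e≢f Te) par′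
          ... | no g≢f   = Reach-edge (keep-member T false g≢f Tg) (inj₁ refl)

        T′-keep : ∀ g → lookup T g ≡ true → g ≢ f → lookup T′ g ≡ true
        T′-keep g Tg g≢f with g ≟ e
        ... | yes refl = keep-member (T [ e ]≔ true) false g≢f (lookup∘update e T true)
        ... | no g≢e   = keep-member (T [ e ]≔ true) false g≢f (keep-member T true g≢e Tg)

        T′-kept : ∀ g → lookup T′ g ≡ true → g ≢ f × (g ≢ e → lookup T g ≡ true)
        T′-kept g T′g = let g≢f , eg = kept-member (T [ e ]≔ true) T′g in
          g≢f , λ g≢e → trans (sym (lookup∘update′ g≢e T true)) eg

        conn′ : Conn T′
        conn′ x y = Reach-map (λ x → x) swap (conn span x y)
          where
          swap : ∀ g → lookup T g ≡ true → Reach G T′ (src g) (tgt g)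
          swap g Tg with g ≟ f
          ... | yes refl = Links-Reach K
            (λ h ch → T′-keep h (con≼span span h ch) (live≢dead f-live (con-dead ch)))
            (keep-member (T [ e ]≔ true) false e≢f (lookup∘update e T true)) par′
          ... | no g≢f   = Reach-edge (T′-keep g Tg g≢f) (inj₁ refl)

        -- For `g ≡ e`, removing `e` from `T′` leaves a part of `T` without `f`. Otherwise the
        -- exchange is undone by routing `e` through `f`.
        minimal′ : ∀ g → lookup (L [ f ]≔ false) g ≡ true → lookup T′ g ≡ true → ¬ Conn (T′ [ g ]≔ false)
        minimal′ g L′g T′g conn-g with g ≟ e
        ... | yes refl = minimal span f f-live Tf (Conn-mono sub conn-g)
          where
          sub : (T′ [ e ]≔ false) ≼ (T [ f ]≔ false)
          sub h T″h = let h≢e , T′h = kept-member T′ T″h ; h≢f , Th = T′-kept h T′h in keep-member T false h≢f (Th h≢e)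
        ... | no g≢e = minimal span g (proj₂ (kept-member L L′g)) (proj₂ (T′-kept g T′g) g≢e)
              (λ x y → Reach-map (λ x → x) swap (conn-g x y))
          where
          swap : ∀ h → lookup (T′ [ g ]≔ false) h ≡ true → Reach G (T [ g ]≔ false) (src h) (tgt h)
          swap h T″h with h ≟ e | kept-member T′ T″h
          ... | yes refl | _ = Links-Reach K (con≼remove span (proj₂ (kept-member L L′g)))
            (keep-member T false (proj₁ (kept-member L L′g) ∘ sym) Tf) par
          ... | no h≢e   | h≢g , T′h = Reach-edge (keep-member T false h≢g (proj₂ (T′-kept h T′h) h≢e)) (inj₁ refl)

        agree′ : ∀ g → lookup (L [ f ]≔ false) g ≡ false → lookup T′ g ≡ lookup (con K) g
        agree′ g L′g with g ≟ f
        ... | yes refl = trans (lookup∘update f (T [ e ]≔ true) false) (sym (live-con f f-live))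
        ... | no g≢f   = let Lg = kept-absent L L′g g≢f in
          trans (lookup∘update′ g≢f (T [ e ]≔ true) false)
            (trans (lookup∘update′ (live≢dead e-live Lg) T true) (agree span g Lg))

    module ContractEdge {f a b} (f-live : lookup L f ≡ true) (a≢b : a ≢ b) (link : Links K f a b) where

      open Contract K a≢b link public

      agree-contract : ∀ {T} → lookup T f ≡ true → (∀ g → lookup L g ≡ false → lookup T g ≡ lookup (con K) g) →
        ∀ g → lookup (L [ f ]≔ false) g ≡ false → lookup T g ≡ lookup (con contract) g
      agree-contract Tf agree g L′g with g ≟ f
      ... | yes refl = trans Tf (sym (lookup∘update f (con K) true))
      ... | no g≢f   = trans (agree g (kept-absent L L′g g≢f)) (sym (lookup∘update′ g≢f (con K) true))

      spans-contract : ∀ {T} → lookup T f ≡ true → Spans K L T → Spans contract (L [ f ]≔ false) T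
      spans-contract {T} Tf span = record
        { conn    = conn span
        ; minimal = λ g Lg → minimal span g (proj₂ (kept-member L Lg))
        ; agree   = agree-contract {T} Tf (agree span)
        }

      minor-contract : Minor contract (L [ f ]≔ false)
      minor-contract = record
        { live-con = λ g L′g → let g≢f , Lg = kept-member L L′g in
            trans (lookup∘update′ g≢f (con K) true) (live-con g Lg)
        ; realised = realised′
        }
        where
        realised′ : ∀ g → label′ (src g) ≢ label′ (tgt g) →
          ∃[ h ] (lookup (L [ f ]≔ false) h ≡ true × Links contract h (label′ (src g)) (label′ (tgt g)))
        realised′ g cross with realised g (cross ∘ cong (redirect a b))
        ... | h , Lh , l with h ≟ f
        ...   | no h≢f   = h , keep-member L false h≢f Lh , Links-contract l
        ...   | yes refl = ⊥-elim (true≢false (trans (sym (lookup∘update f (con K) true))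
                             (external contract cross (Links-contract l))))

    -- Covers deletion and contraction alike: `f` is dead afterwards in either case, and `K′`
    -- records whether it was contracted.
    Recursion : Set
    Recursion = ∀ f → lookup L f ≡ true → ∀ K′ → Minor K′ (L [ f ]≔ false) →
      Good (L [ f ]≔ false) (Spans K′ (L [ f ]≔ false))

    -- The only live edge e at x is a coloop of the minor.
    good-pendant : ∀ {x b e} → lookup L e ≡ true → x ≢ b → Links K e x b →
      (∀ g → lookup L g ≡ true → Incident K g x → g ≡ e) → Recursion → Good L (Spans K L)
    good-pendant {x} {b} {e} e-live x≢b link only rec = good-fixed L _ _ e true e-live
      (λ T span → present T span , C.spans-contract (present T span) span) (rec e e-live C.contract C.minor-contract)
      where
      module C = ContractEdge e-live x≢b link
      present : ∀ T → Spans K L T → lookup T e ≡ true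
      present T span =
        let p , q , _ , p∈x , q≡b = Links-joins K link
            g , Tg , g-inc , cross = exit-edge K (conn span p q) p∈x (λ q∈x → x≢b (trans (sym q∈x) q≡b))
        in subst (λ g → lookup T g ≡ true) (only g (live-cross span g Tg cross) g-inc) Tg

    -- Some live edge of a spanning set leaves the fibre of `x`, so a set without `f` contains `e`,
    -- and replacing `e` by `f` gives a spanning set of the contraction of `f`: the doubling with
    -- `c` true.
    good-series : ∀ {x a b e f} → e ≢ f → lookup L e ≡ true → lookup L f ≡ true → x ≢ a → x ≢ b →
      Links K e x a → Links K f x b → (∀ g → lookup L g ≡ true → Incident K g x → g ≡ e ⊎ g ≡ f) →
      Recursion → Good L (Spans K L)
    good-series {x} {a} {b} {e} {f} e≢f e-live f-live x≢a x≢b link-e link-f only rec =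
      good-duplicate L _ _ e f true e≢f e-live f-live cases (rec f f-live C.contract C.minor-contract)
      where
      module C = ContractEdge f-live x≢b link-f
      cases : ∀ T → Spans K L T → (lookup T f ≡ true × Spans C.contract (L [ f ]≔ false) T) ⊎
        (lookup T f ≡ false × lookup T e ≡ true × Spans C.contract (L [ f ]≔ false) ((T [ e ]≔ false) [ f ]≔ true))
      cases T span with lookup T f in Tf
      ... | true  = inj₁ (refl , C.spans-contract Tf span)
      ... | false = inj₂ (refl , Te , record
        { conn = conn′ ; minimal = minimal′ ; agree = C.agree-contract {T′} (lookup∘update f (T [ e ]≔ false) true) agree′ })
        where
        T′ = (T [ e ]≔ false) [ f ]≔ true

        f-absent : ∀ {g} → lookup T g ≡ true → g ≢ f
        f-absent Tg refl = true≢false (trans (sym Tg) Tf)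

        only-e : ∀ g → lookup T g ≡ true → Incident K g x → label K (src g) ≢ label K (tgt g) → g ≡ e
        only-e g Tg inc cross =
          [ (λ g≡e → g≡e) , (λ g≡f → ⊥-elim (f-absent Tg g≡f)) ]′ (only g (live-cross span g Tg cross) inc)

        Te : lookup T e ≡ true
        Te =
          let p , q , _ , p∈x , q≡b = Links-joins K link-f
              g , Tg , inc , cross = exit-edge K (conn span p q) p∈x (λ q∈x → x≢b (trans (sym q∈x) q≡b))
          in subst (λ g → lookup T g ≡ true) (only-e g Tg inc cross) Tg

        T′-keep : ∀ g → lookup T g ≡ true → g ≢ e → lookup T′ g ≡ true
        T′-keep g Tg g≢e = keep-member (T [ e ]≔ false) true (f-absent Tg) (keep-member T false g≢e Tg)

        T′-kept : ∀ g → lookup T′ g ≡ true → g ≢ f → g ≢ e × lookup T g ≡ true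
        T′-kept g T′g g≢f = kept-member T (trans (sym (lookup∘update′ g≢f (T [ e ]≔ false) true)) T′g)

        conn′ : Conn T′
        conn′ = reroute K x≢a x≢b link-e link-f only-e T′-keep (lookup∘update f (T [ e ]≔ false) true)
          (λ g cg → T′-keep g (con≼span span g cg) (live≢dead e-live (con-dead cg))) (conn span)

        -- `reroute` is applied backwards, from `f` to `e`, with `g` removed on both sides.
        minimal′ : ∀ g → lookup (L [ f ]≔ false) g ≡ true → lookup T′ g ≡ true → ¬ Conn (T′ [ g ]≔ false)
        minimal′ g L′g T′g conn-g = minimal span g g-live Tg
          (reroute K x≢b x≢a link-f link-e only-f keep (keep-member T false (g≢e ∘ sym) Te) (con≼remove span g-live) conn-g)
          where
          g≢f = proj₁ (kept-member L L′g)
          g-live = proj₂ (kept-member L L′g)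
          g≢e = proj₁ (T′-kept g T′g g≢f)
          Tg = proj₂ (T′-kept g T′g g≢f)
          keep : ∀ h → lookup (T′ [ g ]≔ false) h ≡ true → h ≢ f → lookup (T [ g ]≔ false) h ≡ true
          keep h T″h h≢f = let h≢g , T′h = kept-member T′ T″h in keep-member T false h≢g (proj₂ (T′-kept h T′h h≢f))
          only-f : ∀ h → lookup (T′ [ g ]≔ false) h ≡ true → Incident K h x → label K (src h) ≢ label K (tgt h) → h ≡ f
          only-f h T″h inc cross with h ≟ f
          ... | yes h≡f = h≡f
          ... | no h≢f  = let h≢e , Th = T′-kept h (proj₂ (kept-member T′ T″h)) h≢f in
            ⊥-elim (h≢e (only-e h Th inc cross))

        agree′ : ∀ g → lookup L g ≡ false → lookup T′ g ≡ lookup (con K) g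
        agree′ g Lg = trans (lookup∘update′ (live≢dead f-live Lg) (T [ e ]≔ false) true)
          (trans (lookup∘update′ (live≢dead e-live Lg) T false) (agree span g Lg))

    module Simple (no-loop : ∀ e → lookup L e ≡ true → label K (src e) ≢ label K (tgt e))
      (no-parallel : ∀ e f → lookup L e ≡ true → lookup L f ≡ true → Links K f (label K (src e)) (label K (tgt e)) → e ≡ f)
      (rec : Recursion) where

      Live : Fin v → Fin m → Set
      Live x e = lookup L e ≡ true × Incident K e x

      live? : ∀ x e → Dec (Live x e)
      live? x e = (lookup L e ≟ᵇ true) ×-dec incident? K e x

      distinct-ends : ∀ {x b c e f} → lookup L e ≡ true → lookup L f ≡ true → Links K e x b → Links K f x c → e ≢ f → b ≢ c
      distinct-ends e-live f-live (inj₁ (refl , refl)) lf e≢f refl = e≢f (no-parallel _ _ e-live f-live lf)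
      distinct-ends e-live f-live (inj₂ (refl , refl)) lf e≢f refl = e≢f (no-parallel _ _ e-live f-live (Links-sym K lf))

      -- By `realised`, no live edge at `x` means no neighbour. One is a pendant edge, two form a
      -- series pair, and three lead to distinct neighbours for lack of loops and parallel edges.
      low-degree : ∀ x → (∃ (Adj K x) → Deg3 K x) ⊎ Good L (Spans K L)
      low-degree x with any? (live? x)
      ... | no none = inj₁ (λ (y , x≢y , g , l) → ⊥-elim (none (realise x≢y l)))
        where
        realise : ∀ {y g} → x ≢ y → Links K g x y → ∃ (Live x)
        realise {g = g} x≢y (inj₁ (refl , refl)) = let h , Lh , l = realised g x≢y in h , Lh , [ inj₁ ∘ proj₁ , inj₂ ∘ proj₂ ]′ l
        realise {g = g} x≢y (inj₂ (refl , refl)) = let h , Lh , l = realised g (x≢y ∘ sym) in h , Lh , [ inj₂ ∘ proj₂ , inj₁ ∘ proj₁ ]′ l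
      ... | yes (e , e-live , e-inc) with cross-link K (no-loop e e-live) e-inc | any? (λ f → ¬? (f ≟ e) ×-dec live? x f)
      ...   | a , x≢a , link-e | no none = inj₂ (good-pendant e-live x≢a link-e only rec)
        where
        only : ∀ g → lookup L g ≡ true → Incident K g x → g ≡ e
        only g Lg inc with g ≟ e
        ... | yes g≡e = g≡e
        ... | no g≢e  = ⊥-elim (none (g , g≢e , Lg , inc))
      ...   | a , x≢a , link-e | yes (f , f≢e , f-live , f-inc)
        with cross-link K (no-loop f f-live) f-inc | any? (λ g → ¬? (g ≟ e) ×-dec ¬? (g ≟ f) ×-dec live? x g)
      ...     | b , x≢b , link-f | no none = inj₂ (good-series (f≢e ∘ sym) e-live f-live x≢a x≢b link-e link-f only rec)
        where
        only : ∀ g → lookup L g ≡ true → Incident K g x → g ≡ e ⊎ g ≡ f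
        only g Lg inc with g ≟ e | g ≟ f
        ... | yes g≡e | _       = inj₁ g≡e
        ... | no _    | yes g≡f = inj₂ g≡f
        ... | no g≢e  | no g≢f  = ⊥-elim (none (g , g≢e , g≢f , Lg , inc))
      ...     | b , x≢b , link-f | yes (g , g≢e , g≢f , g-live , g-inc) with cross-link K (no-loop g g-live) g-inc
      ...       | c , x≢c , link-g = inj₁ λ _ → a , b , c , (x≢a , e , link-e) , (x≢b , f , link-f) , (x≢c , g , link-g) ,
        distinct-ends e-live f-live link-e link-f (f≢e ∘ sym) ,
        distinct-ends e-live g-live link-e link-g (g≢e ∘ sym) ,
        distinct-ends f-live g-live link-f link-g (g≢f ∘ sym)

      good-simple : ¬ K4Model G → Good L (Spans K L)
      good-simple no-k4 with any? (λ e → lookup L e ≟ᵇ true) | search low-degree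
      ... | _              | inj₂ (_ , good) = good
      ... | no none        | inj₁ _          = good-none L (Spans K L) dead
        where
        dead : ∀ e → lookup L e ≡ false
        dead e with lookup L e in Le
        ... | false = refl
        ... | true  = ⊥-elim (none (e , Le))
      -- The ends of a live edge have distinct labels, so its source is a nonisolated root.
      ... | yes (e , live) | inj₁ deg = ⊥-elim (no-k4 (rooted-k4 (suc (rank K)) K (label K (src e)) ≤-refl
        ((label K (tgt e) , no-loop e live , e , inj₁ (refl , refl)) , λ x _ → deg x)))

    good-step : ¬ K4Model G → Recursion → Good L (Spans K L)
    good-step no-k4 rec
      with any? (λ e → (lookup L e ≟ᵇ true) ×-dec (label K (src e) ≟ label K (tgt e)))
         | any? (λ e → any? (λ f → ¬? (e ≟ f) ×-dec (lookup L e ≟ᵇ true) ×-dec (lookup L f ≟ᵇ true) ×-dec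
             links? K f (label K (src e)) (label K (tgt e))))
    ... | yes (e , live , loop) | _ = good-loop e live loop (rec e live K)
    ... | no _ | yes (e , f , e≢f , e-live , f-live , par) = good-parallel e f e≢f e-live f-live par (rec f f-live K)
    ... | no no-loop | no no-parallel =
      Simple.good-simple (λ e live loop → no-loop (e , live , loop)) parallel⇒≡ rec no-k4
      where
      parallel⇒≡ : ∀ e f → lookup L e ≡ true → lookup L f ≡ true → Links K f (label K (src e)) (label K (tgt e)) → e ≡ f
      parallel⇒≡ e f e-live f-live par with e ≟ f
      ... | yes e≡f = e≡f
      ... | no e≢f  = ⊥-elim (no-parallel (e , f , e≢f , e-live , f-live , par))

  -- Induction on the number of live edges: every reduction makes exactly one of them dead.
  good-minor : ¬ K4Model G → ∀ fuel K L → countTrue L < fuel → Minor K L → Good L (Spans K L)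
  good-minor no-k4 (suc fuel) K L (s≤s count≤) minor = Reduce.good-step K L minor no-k4 λ f live K′ →
    good-minor no-k4 fuel K′ (L [ f ]≔ false) (≤-trans (≤-reflexive (countTrue-remove L f live)) count≤)

  -- The graph as a minor of itself, and the theorem

  trivial-contraction : Contraction
  trivial-contraction = record
    { label    = λ x → x
    ; con      = replicate m false
    ; fibre    = λ { refl → here }
    ; internal = λ e ce → ⊥-elim (true≢false (trans (sym ce) (lookup-replicate e false)))
    }

  trivial-minor : Minor trivial-contraction (replicate m true)
  trivial-minor = record
    { live-con = λ e _ → lookup-replicate e false
    ; realised = λ e _ → e , lookup-replicate e true , inj₁ (refl , refl)
    }

  -- If the tree without `g` were still connected, it would join the ends of `g`, against
  -- acyclicity.
  spanning-tree-spans : ∀ T → X G T → Spans trivial-contraction (replicate m true) T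
  spanning-tree-spans T (conn , acyclic) = record
    { conn    = conn
    ; minimal = λ g _ Tg conn-g → acyclic g Tg (conn-g (src g) (tgt g))
    ; agree   = λ g dead → ⊥-elim (true≢false (trans (sym (lookup-replicate g true)) dead))
    }

theorem1p1 : ∀ {v m : ℕ} (G : Multigraph v m) → Connected G → SeriesParallel G →
    ∃[ p ] ∃[ q ] ∃[ C ] ∃[ N ] (1 ≤ p × 1 ≤ q ×
    (∀ (n : ℕ) → N ≤ n → ∀ (S : Vec Bool n → Bool) → XFree {m} {n} (X G) S →
    card S ^ q * n ^ p ≤ C * 2 ^ (n * q)))
theorem1p1 {m = m} G _ no-k4 = good⇒power-saving (X G) (Spans G K L) (spanning-tree-spans G)
  (good-minor G no-k4 (suc (countTrue L)) K L ≤-refl (trivial-minor G))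
  where
  K = trivial-contraction G
  L = replicate m true
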